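{- Let $m$ be a positive integer such that $q=4m^2+1$ is a prime power $q=p^r$ with $p$ a prime congruent to $1$ modulo $4$. Let $k$ be the odd integer with $k\le \sqrt{q}<k+2$. Then there exists a conference matrix $W$ of order $q+1$ with maximum excess attaining the upper bound $$E(W)=\frac{(q+1)(k^2+2k+q)}{2(k+1)};$$ that is, $E(W)$ equals this value, and every conference matrix $W'$ of order $q+1$ satisfies $E(W')\le \frac{(q+1)(k^2+2k+q)}{2(k+1)}$.
   Context: A conference matrix of order $n$ is an $n\times n$ matrix $W$ with entries in $\{0,-1,1\}$ and zero diagonal satisfying $WW^T=(n-1)I$, where $I$ is the $n\times n$ identity matrix. The excess $E(W)$ is the sum of all entries of $W$. -}

module Defs where

open import Data.Bool.Base using (if_then_else_)
open import Data.Fin.Base using (Fin)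
open import Data.Fin.Properties using (_≟_)
open import Data.Integer.Base as ℤ using (ℤ; +_; -1ℤ; 0ℤ; 1ℤ)
open import Data.Integer.Properties using (+-*-semiring)
open import Data.Nat.Base as ℕ using (ℕ; suc)
open import Data.Rational.Base as ℚ using (ℚ)
open import Data.Sum.Base using (_⊎_)
open import Data.Vec.Functional using (Vector; transpose)
open import Relation.Binary.PropositionalEquality.Core using (_≡_)
open import Relation.Nullary.Decidable.Core using (does)

open import Algebra.Properties.Semiring.Sum +-*-semiring using (sum-syntax)

Matrix : ℕ → Set
Matrix n = Vector (Vector ℤ n) n

infixl 7 _⊗_ _·_

_⊗_ : ∀ {n} → Matrix n → Matrix n → Matrix n
_⊗_ {n} A B i j = ∑[ l < n ] (A i l ℤ.* B l j)

_·_ : ∀ {n} → ℤ → Matrix n → Matrix n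
(c · A) i j = c ℤ.* A i j

identity : ∀ n → Matrix n
identity n i j = if does (i ≟ j) then 1ℤ else 0ℤ

record IsConference {n : ℕ} (W : Matrix n) : Set where
  field
    entries      : ∀ i j → W i j ≡ 0ℤ ⊎ W i j ≡ -1ℤ ⊎ W i j ≡ 1ℤ
    zeroDiagonal : ∀ i → W i i ≡ 0ℤ
    -- Matrices are functions, so their equality is stated entrywise.
    orthogonal   : ∀ i j → (W ⊗ transpose W) i j ≡ ((+ n ℤ.- 1ℤ) · identity n) i j

excess : ∀ {n} → Matrix n → ℤ
excess {n} W = ∑[ i < n ] (∑[ j < n ] W i j)

-- The denominator 2(k + 1) uses suc k so that it is visibly nonzero.
excessBound : ℕ → ℕ → ℚ
excessBound q k =
  (+ ((q ℕ.+ 1) ℕ.* (k ℕ.^ 2 ℕ.+ 2 ℕ.* k ℕ.+ q))) ℚ./ (2 ℕ.* suc k)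

{-# OPTIONS --safe #-}
module Submission where

-- Put x = 2m, so that q = x² + 1, k = x - 1, n = q + 1 and the bound equals nx. The column sums c of a
-- conference matrix of order n are odd with ∑ c² = n(n - 1), hence
--   0 ≤ ∑ ((c - x)² - 1) = 2x (nx - E),
-- with equality exactly when every c is x ± 1.
--
-- For a prime p ≡ 1 (mod 4) let C be the Paley matrix χ(det(u, v)) on the projective line over F_p, and let N be
-- the norm form of F_p(√g) for a nonresidue g. Each point has a representative v with N v = 1 or N v = 1/g, unique up
-- to sign, and χ is even, so passing to these representatives conjugates C by a diagonal sign matrix. Multiplication
-- by elements of F_p(√g) permutes the points, scales det and N by the same factor, and shows that the new matrix
-- consists of blocks with constant row sums (α β; β -α), up to row signs. Orthogonality gives α² + β² = p.
--
-- As in Lebesgue's theorem, q = pʳ = x² + 1 forces r = 1: write 1 + xi = ±πʳ in ℤ[i], where p = α² + β² provides π,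
-- and compare real parts 2-adically. Hence α² + β² = x² + 1 is prime, {|α|, |β|} = {1, x}, and all row sums are
-- x ± 1 up to sign.

open import Defs
open import Data.Product using (_×_; Σ-syntax; ∃; _,_; proj₁; proj₂)
open import Data.Nat.Primality using (Prime; euclidsLemma; prime⇒nonZero; prime⇒nonTrivial; ¬prime[1])
open import Relation.Nullary using (¬_; yes; no; Dec; does; contradiction; ¬?)
open import Relation.Binary.PropositionalEquality

-- Neither F_p nor F_p(√g) is built: elements of F_p are integers up to congruence, and
-- multiplication by x + y√g is the integer matrix with rows (x, gy) and (y, x). It permutes the
-- projective points, but tracking chosen representatives through this permutation would be awkward.
-- Each sum over points is therefore turned into a sum over all vectors of the plane, which is p - 1
-- times as large and invariant under invertible linear substitutions. The special representatives
-- survive only as signs: if N v = s², then v / s has norm 1, and dividing by s costs the factor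
-- χ(s). The construction is used twice. For an arbitrary exponent r, p divides x² + 1, so x itself
-- is a square root of -1 modulo p, χ is even, and the resulting α + βi is the Gaussian prime that
-- the argument for r = 1 needs. Once p = x² + 1 is known, the construction is repeated, and
-- factorisation in ℤ[i] then determines α and β up to order and signs.

module ConferenceMatrices where

  open import Data.Bool.Base using (if_then_else_)
  open import Data.Fin.Base using (Fin; zero; suc; toℕ; fromℕ<; punchIn)
  import Data.Fin.Properties as Fin
  open import Data.Integer.Base as ℤ hiding (suc; ∣_∣; _^_)
  open import Data.Integer.DivMod using (_%ℕ_; _/ℕ_; n%ℕd<d; a≡a%ℕn+[a/ℕn]*n)
  open import Data.Integer.Divisibility.Signed
  import Data.Integer.Properties as ℤ
  open import Data.Integer.Tactic.RingSolver using (solve-∀)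
  open import Data.Nat.Base as ℕ using (ℕ; zero; suc)
  open import Data.Nat.Coprimality using (prime⇒coprime; coprime-Bézout)
  import Data.Nat.Divisibility as ℕ
  open import Data.Nat.GCD using (module Bézout)
  open import Data.Nat.Induction using (<-rec)
  import Data.Nat.Properties as ℕ
  open import Data.Sum.Base as Sum using (_⊎_; inj₁; inj₂)
  open import Data.Vec.Functional using (transpose)
  open import Function.Base using (_∘_)
  open import Relation.Nullary.Decidable using (dec-true; dec-false; _×-dec_; map′)
  open import Algebra.Properties.Semiring.Sum ℤ.+-*-semiring

  open ≡-Reasoning

  -- Finite sums

  sum-single : ∀ {n} (f : Fin n → ℤ) i → (∀ j → j ≢ i → f j ≡ 0ℤ) → sum f ≡ f i
  sum-single {suc n} f i f≡0 = begin
    sum f                                     ≡⟨ sum-remove {i = i} f ⟩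
    f i + ∑[ j < n ] f (punchIn i j)    ≡⟨ cong (_+_ (f i)) (sum-cong-≗ λ j → f≡0 _ (Fin.punchInᵢ≢i i j)) ⟩
    f i + ∑[ j < n ] 0ℤ                       ≡⟨ cong (_+_ (f i)) (sum-replicate-zero n) ⟩
    f i + 0ℤ                                  ≡⟨ ℤ.+-identityʳ _ ⟩
    f i                                       ∎

  sum-const : ∀ n c → ∑[ i < n ] c ≡ + n * c
  sum-const zero    c = refl
  sum-const (suc n) c = begin
    c + ∑[ i < n ] c  ≡⟨ cong (_+_ c) (sum-const n c) ⟩
    c + + n * c       ≡⟨ lemma c (+ n) ⟩
    (1ℤ + + n) * c    ∎
    where
    lemma : ∀ c m → c + m * c ≡ (1ℤ + m) * c
    lemma = solve-∀

  sum-neg : ∀ {n} (f : Fin n → ℤ) → ∑[ i < n ] (- f i) ≡ - sum f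
  sum-neg {n} f = begin
    ∑[ i < n ] (- f i)       ≡⟨ sum-cong-≗ (λ i → sym (ℤ.-1*i≡-i (f i))) ⟩
    ∑[ i < n ] (-1ℤ * f i)   ≡⟨ *-distribˡ-sum -1ℤ f ⟨
    -1ℤ * sum f              ≡⟨ ℤ.-1*i≡-i (sum f) ⟩
    - sum f                  ∎

  ∑-distrib-- : ∀ {n} (f g : Fin n → ℤ) → ∑[ i < n ] (f i - g i) ≡ sum f - sum g
  ∑-distrib-- f g = trans (∑-distrib-+ f (-_ ∘ g)) (cong (_+_ (sum f)) (sum-neg g))

  sum-nonneg : ∀ {n} (f : Fin n → ℤ) → (∀ i → 0ℤ ≤ f i) → 0ℤ ≤ sum f
  sum-nonneg {zero}  f 0≤f = ℤ.≤-refl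
  sum-nonneg {suc n} f 0≤f = ℤ.+-mono-≤ (0≤f _) (sum-nonneg (f ∘ suc) (0≤f ∘ suc))

  -- Turns one global count into a pointwise identity, for `χ-nonsquare-*`, `nonresidue` and
  -- `entry²`.
  sum-nonneg-zero : ∀ {n} (f : Fin n → ℤ) → (∀ i → 0ℤ ≤ f i) → sum f ≡ 0ℤ → ∀ i → f i ≡ 0ℤ
  sum-nonneg-zero {suc n} f 0≤f sum≡0 i = ℤ.≤-antisym fi≤0 (0≤f i)
    where
    fi≤0 : f i ≤ 0ℤ
    fi≤0 = subst₂ _≤_ (ℤ.+-identityʳ (f i)) (trans (sym (sum-remove {i = i} f)) sum≡0)
      (ℤ.+-monoʳ-≤ (f i) (sum-nonneg (f ∘ punchIn i) (0≤f ∘ punchIn i)))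

  identity-diagonal : ∀ n i → identity n i i ≡ 1ℤ
  identity-diagonal n i = cong (if_then 1ℤ else 0ℤ) (dec-true (i Fin.≟ i) refl)

  identity-off-diagonal : ∀ n {i j} → i ≢ j → identity n i j ≡ 0ℤ
  identity-off-diagonal n {i} {j} i≢j = cong (if_then 1ℤ else 0ℤ) (dec-false (i Fin.≟ j) i≢j)

  sum-*-identity : ∀ n i (f : Fin n → ℤ) → ∑[ j < n ] (f j * identity n i j) ≡ f i
  sum-*-identity n i f = begin
    ∑[ j < n ] (f j * identity n i j) ≡⟨ sum-single _ i (λ j j≢i →
      trans (cong (f j *_) (identity-off-diagonal n (j≢i ∘ sym))) (ℤ.*-zeroʳ (f j))) ⟩
    f i * identity n i i              ≡⟨ cong (f i *_) (identity-diagonal n i) ⟩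
    f i * 1ℤ                          ≡⟨ ℤ.*-identityʳ (f i) ⟩
    f i                               ∎

  sum-identity : ∀ n i → sum (identity n i) ≡ 1ℤ
  sum-identity n i = trans (sum-cong-≗ λ j → sym (ℤ.*-identityˡ (identity n i j))) (sum-*-identity n i (λ _ → 1ℤ))

  -- Congruences modulo a prime

  ∣-≡ : ∀ {d x y} → d ∣ x → y ≡ x → d ∣ y
  ∣-≡ d∣x refl = d∣x

  ∣-multiple : ∀ {d x y} u → d ∣ x → y ≡ u * x → d ∣ y
  ∣-multiple u d∣x eq = ∣-≡ (∣n⇒∣m*n u d∣x) eq

  ∣-combination : ∀ {d x y z} u v → d ∣ x → d ∣ y → z ≡ u * x + v * y → d ∣ z
  ∣-combination u v d∣x d∣y eq = ∣-≡ (∣m∣n⇒∣m+n (∣n⇒∣m*n u d∣x) (∣n⇒∣m*n v d∣y)) eq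

  module Residues (p : ℕ) (p-prime : Prime p) where

    instance
      p≢0 : ℕ.NonZero p
      p≢0 = prime⇒nonZero p-prime

    P : ℤ
    P = + p

    infix 4 _≈_
    -- A record, so that `a` and `b` can be inferred from a proof; the difference `a - b` alone does
    -- not determine them.
    record _≈_ (a b : ℤ) : Set where
      constructor ∣⇒≈
      field ≈⇒∣ : P ∣ a - b
    open _≈_

    ≈-reflexive : ∀ {a b} → a ≡ b → a ≈ b
    ≈-reflexive {a} refl = ∣⇒≈ (∣-multiple 0ℤ ∣-refl (ℤ.+-inverseʳ a))

    ≈-sym : ∀ {a b} → a ≈ b → b ≈ a
    ≈-sym {a} {b} (∣⇒≈ a≈b) = ∣⇒≈ (∣-multiple -1ℤ a≈b (lemma a b))
      where
      lemma : ∀ a b → b - a ≡ -1ℤ * (a - b)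
      lemma = solve-∀

    ≈-trans : ∀ {a b c} → a ≈ b → b ≈ c → a ≈ c
    ≈-trans {a} {b} {c} (∣⇒≈ a≈b) (∣⇒≈ b≈c) = ∣⇒≈ (∣-combination 1ℤ 1ℤ a≈b b≈c (lemma a b c))
      where
      lemma : ∀ a b c → a - c ≡ 1ℤ * (a - b) + 1ℤ * (b - c)
      lemma = solve-∀

    +-≈ : ∀ {a b c d} → a ≈ b → c ≈ d → a + c ≈ b + d
    +-≈ {a} {b} {c} {d} (∣⇒≈ a≈b) (∣⇒≈ c≈d) = ∣⇒≈ (∣-combination 1ℤ 1ℤ a≈b c≈d (lemma a b c d))
      where
      lemma : ∀ a b c d → (a + c) - (b + d) ≡ 1ℤ * (a - b) + 1ℤ * (c - d)
      lemma = solve-∀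

    *-≈ : ∀ {a b c d} → a ≈ b → c ≈ d → a * c ≈ b * d
    *-≈ {a} {b} {c} {d} (∣⇒≈ a≈b) (∣⇒≈ c≈d) = ∣⇒≈ (∣-combination c b a≈b c≈d (lemma a b c d))
      where
      lemma : ∀ a b c d → a * c - b * d ≡ c * (a - b) + b * (c - d)
      lemma = solve-∀

    -‿≈ : ∀ {a b} → a ≈ b → - a ≈ - b
    -‿≈ {a} {b} (∣⇒≈ a≈b) = ∣⇒≈ (∣-multiple -1ℤ a≈b (lemma a b))
      where
      lemma : ∀ a b → - a - - b ≡ -1ℤ * (a - b)
      lemma = solve-∀

    ∣-resp-≈ : ∀ {a b} → a ≈ b → P ∣ a → P ∣ b
    ∣-resp-≈ {a} {b} (∣⇒≈ a≈b) p∣a = ∣-combination 1ℤ -1ℤ p∣a a≈b (lemma a b)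
      where
      lemma : ∀ a b → b ≡ 1ℤ * a + -1ℤ * (a - b)
      lemma = solve-∀

    opaque
      euclid : ∀ a b → P ∣ a * b → P ∣ a ⊎ P ∣ b
      euclid a b p∣ab = Sum.map ∣ᵤ⇒∣ ∣ᵤ⇒∣
        (euclidsLemma ℤ.∣ a ∣ ℤ.∣ b ∣ p-prime (subst (p ℕ.∣_) (ℤ.abs-* a b) (∣⇒∣ᵤ p∣ab)))

    ∣-cancelˡ : ∀ a b → ¬ P ∣ a → P ∣ a * b → P ∣ b
    ∣-cancelˡ a b p∤a p∣ab with euclid a b p∣ab
    ... | inj₁ p∣a = contradiction p∣a p∤a
    ... | inj₂ p∣b = p∣b

    ∤-* : ∀ a b → ¬ P ∣ a → ¬ P ∣ b → ¬ P ∣ a * b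
    ∤-* a b p∤a p∤b p∣ab = p∤b (∣-cancelˡ a b p∤a p∣ab)

    p∤1 : ¬ P ∣ 1ℤ
    p∤1 p∣1 with refl ← ℕ.∣1⇒≡1 (∣⇒∣ᵤ p∣1) with () ← ℕ.nonTrivial⇒≢1 {{prime⇒nonTrivial p-prime}} refl

    ∣-small⇒≡0 : ∀ a → ℤ.∣ a ∣ ℕ.< p → P ∣ a → a ≡ 0ℤ
    ∣-small⇒≡0 a ∣a∣<p p∣a with ℤ.∣ a ∣ in eq
    ... | zero  = ℤ.∣i∣≡0⇒i≡0 eq
    ... | suc k = contradiction (subst (p ℕ.∣_) eq (∣⇒∣ᵤ p∣a)) (ℕ.>⇒∤ ∣a∣<p)

    ι : Fin p → ℤ
    ι i = + toℕ i

    residue : ℤ → Fin p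
    residue a = fromℕ< (n%ℕd<d a p)

    ι-residue : ∀ a → ι (residue a) ≈ a
    ι-residue a rewrite Fin.toℕ-fromℕ< (n%ℕd<d a p) =
      ∣⇒≈ (∣-multiple (- (a /ℕ p)) ∣-refl
        (trans (cong (_-_ (+ (a %ℕ p))) (a≡a%ℕn+[a/ℕn]*n a p)) (lemma (+ (a %ℕ p)) (a /ℕ p) P)))
      where
      lemma : ∀ r q d → r - (r + q * d) ≡ - q * d
      lemma = solve-∀

    ι-injective : ∀ {i j} → ι i ≈ ι j → i ≡ j
    ι-injective {i} {j} i≈j = Fin.toℕ-injective (ℤ.+-injective (ℤ.i-j≡0⇒i≡j _ _
      (∣-small⇒≡0 (ι i - ι j) ∣i-j∣<p (≈⇒∣ i≈j))))
      where
      ∣i-j∣<p : ℤ.∣ ι i - ι j ∣ ℕ.< p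
      ∣i-j∣<p = subst (ℕ._< p) (cong ℤ.∣_∣ (sym (ℤ.m-n≡m⊖n (toℕ i) (toℕ j))))
        (ℕ.≤-<-trans (ℤ.∣m⊝n∣≤m⊔n (toℕ i) (toℕ j)) (ℕ.⊔-lub (Fin.toℕ<n i) (Fin.toℕ<n j)))

    opaque
      inverse : ∀ a → ¬ P ∣ a → ∃ λ b → b * a ≈ 1ℤ
      inverse a p∤a = from-ℕ (toℕ (residue a)) refl
        where
        lift₁ : ∀ {x y r} → 1 ℕ.+ y ℕ.* r ≡ x ℕ.* p → - + y * + r - 1ℤ ≡ - + x * P
        lift₁ {x} {y} {r} eq = trans (lemma (+ y) (+ r))
          (trans (cong (λ s → - s) (trans (cong (_+_ 1ℤ) (sym (ℤ.pos-* y r))) (trans (cong (+_) eq) (ℤ.pos-* x p))))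
            (ℤ.neg-distribˡ-* (+ x) P))
          where
          lemma : ∀ y r → - y * r - 1ℤ ≡ - (1ℤ + y * r)
          lemma = solve-∀
        lift₂ : ∀ {x y r} → 1 ℕ.+ x ℕ.* p ≡ y ℕ.* r → + y * + r - 1ℤ ≡ + x * P
        lift₂ {x} {y} {r} eq = trans (cong (_- 1ℤ) (trans (sym (ℤ.pos-* y r)) (trans (cong (+_) (sym eq))
          (cong (_+_ 1ℤ) (ℤ.pos-* x p))))) (lemma (+ x * P))
          where
          lemma : ∀ t → 1ℤ + t - 1ℤ ≡ t
          lemma = solve-∀
        transfer : ∀ b → b * ι (residue a) ≈ 1ℤ → b * a ≈ 1ℤ
        transfer b = ≈-trans (*-≈ (≈-reflexive {b} refl) (≈-sym (ι-residue a)))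
        from-ℕ : ∀ r → toℕ (residue a) ≡ r → ∃ λ b → b * a ≈ 1ℤ
        from-ℕ zero eq = contradiction (∣-resp-≈ (ι-residue a) (subst (λ r → P ∣ + r) (sym eq) (divides 0ℤ refl))) p∤a
        from-ℕ (suc r) eq with coprime-Bézout (prime⇒coprime p-prime (subst (ℕ._< p) eq (Fin.toℕ<n (residue a))))
        -- Here `y * suc r` is one less than a multiple of `p`, so the inverse is `- y`; in the
        -- other case it is one more, and the inverse is `y`.
        ... | Bézout.+- x y e = - + y , transfer (- + y)
          (∣⇒≈ (∣-multiple (- + x) ∣-refl (trans (cong (λ s → - + y * + s - 1ℤ) eq) (lift₁ {x} {y} e))))
        ... | Bézout.-+ x y e = + y , transfer (+ y)
          (∣⇒≈ (∣-multiple (+ x) ∣-refl (trans (cong (λ s → + y * + s - 1ℤ) eq) (lift₂ {x} {y} e))))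

    -- Functions on F_p are modelled as functions on ℤ that respect congruence, so that polynomial
    -- identities over ℤ apply directly to their arguments.
    Periodic : (ℤ → ℤ) → Set
    Periodic f = ∀ {a b} → a ≈ b → f a ≡ f b

    ∑ₚ : (ℤ → ℤ) → ℤ
    ∑ₚ f = ∑[ i < p ] f (ι i)

    ∑ₚ-comm : ∀ (F : ℤ → ℤ → ℤ) → ∑ₚ (λ x → ∑ₚ λ y → F x y) ≡ ∑ₚ (λ y → ∑ₚ λ x → F x y)
    ∑ₚ-comm F = ∑-comm (λ i j → F (ι i) (ι j))

    *-distribˡ-∑ₚ : ∀ c f → c * ∑ₚ f ≡ ∑ₚ (λ x → c * f x)
    *-distribˡ-∑ₚ c f = *-distribˡ-sum c (f ∘ ι)

    ∑ₚ-cong : ∀ {f g : ℤ → ℤ} → (∀ x → f x ≡ g x) → ∑ₚ f ≡ ∑ₚ g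
    ∑ₚ-cong f≗g = sum-cong-≗ (λ i → f≗g (ι i))

    opaque
      δ : ℤ → ℤ
      δ a = if does (P ∣? a) then 1ℤ else 0ℤ

      δ-∣ : ∀ {a} → P ∣ a → δ a ≡ 1ℤ
      δ-∣ {a} p∣a = cong (if_then 1ℤ else 0ℤ) (dec-true (P ∣? a) p∣a)

      δ-∤ : ∀ {a} → ¬ P ∣ a → δ a ≡ 0ℤ
      δ-∤ {a} p∤a = cong (if_then 1ℤ else 0ℤ) (dec-false (P ∣? a) p∤a)

    δ-⇔ : ∀ {a b} → (P ∣ a → P ∣ b) → (P ∣ b → P ∣ a) → δ a ≡ δ b
    δ-⇔ {a} {b} a⇒b b⇒a with P ∣? b
    ... | yes p∣b = trans (δ-∣ (b⇒a p∣b)) (sym (δ-∣ p∣b))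
    ... | no  p∤b = trans (δ-∤ (p∤b ∘ a⇒b)) (sym (δ-∤ p∤b))

    δ-periodic : Periodic δ
    δ-periodic a≈b = δ-⇔ (∣-resp-≈ a≈b) (∣-resp-≈ (≈-sym a≈b))

    sift : ∀ {f} → Periodic f → ∀ c → ∑ₚ (λ x → f x * δ (x - c)) ≡ f c
    sift {f} f-periodic c = begin
      ∑ₚ (λ x → f x * δ (x - c))      ≡⟨ sum-single _ r vanish ⟩
      f (ι r) * δ (ι r - c)           ≡⟨ cong₂ _*_ (f-periodic (ι-residue c)) (δ-∣ (≈⇒∣ (ι-residue c))) ⟩
      f c * 1ℤ                        ≡⟨ ℤ.*-identityʳ (f c) ⟩
      f c                             ∎
      where
      r = residue c
      vanish : ∀ i → i ≢ r → f (ι i) * δ (ι i - c) ≡ 0ℤ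
      vanish i i≢r = trans (cong (f (ι i) *_) (δ-∤ λ i≈c → i≢r (ι-injective (≈-trans (∣⇒≈ i≈c) (≈-sym (ι-residue c))))))
        (ℤ.*-zeroʳ (f (ι i)))

    ∑ₚδ≡1 : ∀ c → ∑ₚ (λ x → δ (x - c)) ≡ 1ℤ
    ∑ₚδ≡1 c = trans (∑ₚ-cong (λ x → sym (ℤ.*-identityˡ (δ (x - c))))) (sift {λ _ → 1ℤ} (λ _ → refl) c)

    -- Write `f (φ x)` as a sum over `y` against `δ (y - φ x)`, interchange the sums, and read the
    -- same condition as `x ≈ ψ y`: each `y` then has exactly one preimage. No permutation of
    -- `Fin p` has to be constructed.
    ∑ₚ-reindex : ∀ {f} → Periodic f → ∀ (φ ψ : ℤ → ℤ) →
      (∀ x y → y ≈ φ x → x ≈ ψ y) → (∀ x y → x ≈ ψ y → y ≈ φ x) → ∑ₚ (f ∘ φ) ≡ ∑ₚ f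
    ∑ₚ-reindex {f} f-periodic φ ψ φ⇒ψ ψ⇒φ = begin
      ∑ₚ (f ∘ φ)                                     ≡⟨ ∑ₚ-cong (λ x → sym (sift f-periodic (φ x))) ⟩
      ∑ₚ (λ x → ∑ₚ (λ y → f y * δ (y - φ x)))       ≡⟨ ∑ₚ-comm (λ x y → f y * δ (y - φ x)) ⟩
      ∑ₚ (λ y → ∑ₚ (λ x → f y * δ (y - φ x)))       ≡⟨ ∑ₚ-cong (λ y → ∑ₚ-cong λ x →
        cong (f y *_) (δ-⇔ (≈⇒∣ ∘ φ⇒ψ x y ∘ ∣⇒≈) (≈⇒∣ ∘ ψ⇒φ x y ∘ ∣⇒≈))) ⟩
      ∑ₚ (λ y → ∑ₚ (λ x → f y * δ (x - ψ y)))       ≡⟨ ∑ₚ-cong (λ y → sym (*-distribˡ-∑ₚ (f y) (λ x → δ (x - ψ y)))) ⟩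
      ∑ₚ (λ y → f y * ∑ₚ (λ x → δ (x - ψ y)))       ≡⟨ ∑ₚ-cong (λ y → cong (f y *_) (∑ₚδ≡1 (ψ y))) ⟩
      ∑ₚ (λ y → f y * 1ℤ)                           ≡⟨ ∑ₚ-cong (λ y → ℤ.*-identityʳ (f y)) ⟩
      ∑ₚ f                                          ∎

    ∑ₚ-scale : ∀ {f} → Periodic f → ∀ u → ¬ P ∣ u → ∑ₚ (λ x → f (u * x)) ≡ ∑ₚ f
    ∑ₚ-scale f-periodic u p∤u with inverse u p∤u
    ... | v , ∣⇒≈ vu≈1 = ∑ₚ-reindex f-periodic (u *_) (v *_)
      (λ x y y≈ux → ∣⇒≈ (∣-combination (- v) (- x) (≈⇒∣ y≈ux) vu≈1 (lemma₁ u v x y)))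
      (λ x y x≈vy → ∣⇒≈ (∣-combination (- u) (- y) (≈⇒∣ x≈vy) vu≈1 (lemma₂ u v x y)))
      where
      lemma₁ : ∀ u v x y → x - v * y ≡ - v * (y - u * x) + - x * (v * u - 1ℤ)
      lemma₁ = solve-∀
      lemma₂ : ∀ u v x y → y - u * x ≡ - u * (x - v * y) + - y * (v * u - 1ℤ)
      lemma₂ = solve-∀

    -- Sums over the plane F_p²

    ∑² : (ℤ → ℤ → ℤ) → ℤ
    ∑² F = ∑ₚ λ x → ∑ₚ λ y → F x y

    ∑²-cong : ∀ {F G : ℤ → ℤ → ℤ} → (∀ x y → F x y ≡ G x y) → ∑² F ≡ ∑² G
    ∑²-cong F≗G = ∑ₚ-cong λ x → ∑ₚ-cong (F≗G x)

    *-distribˡ-∑² : ∀ c F → c * ∑² F ≡ ∑² λ x y → c * F x y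
    *-distribˡ-∑² c F = trans (*-distribˡ-∑ₚ c (λ x → ∑ₚ (F x))) (∑ₚ-cong λ x → *-distribˡ-∑ₚ c (F x))

    ∑²-comm : ∀ (F : ℤ → ℤ → ℤ → ℤ → ℤ) →
      (∑² λ x y → ∑² λ a b → F x y a b) ≡ (∑² λ a b → ∑² λ x y → F x y a b)
    ∑²-comm F = begin
      (∑ₚ λ x → ∑ₚ λ y → ∑ₚ λ a → ∑ₚ λ b → F x y a b) ≡⟨ ∑ₚ-cong (λ x → ∑ₚ-comm λ y a → ∑ₚ λ b → F x y a b) ⟩
      (∑ₚ λ x → ∑ₚ λ a → ∑ₚ λ y → ∑ₚ λ b → F x y a b) ≡⟨ ∑ₚ-comm (λ x a → ∑ₚ λ y → ∑ₚ λ b → F x y a b) ⟩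
      (∑ₚ λ a → ∑ₚ λ x → ∑ₚ λ y → ∑ₚ λ b → F x y a b) ≡⟨ ∑ₚ-cong (λ a → ∑ₚ-cong λ x → ∑ₚ-comm λ y b → F x y a b) ⟩
      (∑ₚ λ a → ∑ₚ λ x → ∑ₚ λ b → ∑ₚ λ y → F x y a b) ≡⟨ ∑ₚ-cong (λ a → ∑ₚ-comm λ x b → ∑ₚ λ y → F x y a b) ⟩
      (∑ₚ λ a → ∑ₚ λ b → ∑ₚ λ x → ∑ₚ λ y → F x y a b) ∎

    Periodic² : (ℤ → ℤ → ℤ) → Set
    Periodic² F = ∀ {a b c d} → a ≈ b → c ≈ d → F a c ≡ F b d

    δ² : ℤ → ℤ → ℤ
    δ² a b = δ a * δ b

    δ²-∣ : ∀ {a b} → P ∣ a × P ∣ b → δ² a b ≡ 1ℤ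
    δ²-∣ (p∣a , p∣b) = cong₂ _*_ (δ-∣ p∣a) (δ-∣ p∣b)

    δ²-∤ : ∀ {a b} → ¬ (P ∣ a × P ∣ b) → δ² a b ≡ 0ℤ
    δ²-∤ {a} {b} p∤ with P ∣? a
    ... | yes p∣a = trans (cong (δ a *_) (δ-∤ λ p∣b → p∤ (p∣a , p∣b))) (ℤ.*-zeroʳ (δ a))
    ... | no p∤a = trans (cong (_* δ b) (δ-∤ p∤a)) (ℤ.*-zeroˡ (δ b))

    δ²-⇔ : ∀ {a b c d} → (P ∣ a × P ∣ b → P ∣ c × P ∣ d) → (P ∣ c × P ∣ d → P ∣ a × P ∣ b) → δ² a b ≡ δ² c d
    δ²-⇔ {a} {b} {c} {d} ⇒ ⇐ with P ∣? c ×-dec P ∣? d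
    ... | yes p∣ = trans (δ²-∣ (⇐ p∣)) (sym (δ²-∣ p∣))
    ... | no  p∤ = trans (δ²-∤ (p∤ ∘ ⇒)) (sym (δ²-∤ p∤))

    sift² : ∀ {F} → Periodic² F → ∀ c d → ∑² (λ x y → F x y * δ² (x - c) (y - d)) ≡ F c d
    sift² {F} F-periodic c d = begin
      ∑² (λ x y → F x y * (δ (x - c) * δ (y - d)))
        ≡⟨ ∑²-cong (λ x y → lemma (F x y) (δ (x - c)) (δ (y - d))) ⟩
      ∑ₚ (λ x → ∑ₚ λ y → δ (x - c) * (F x y * δ (y - d)))
        ≡⟨ ∑ₚ-cong (λ x → sym (*-distribˡ-∑ₚ (δ (x - c)) (λ y → F x y * δ (y - d)))) ⟩
      ∑ₚ (λ x → δ (x - c) * ∑ₚ λ y → F x y * δ (y - d))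
        ≡⟨ ∑ₚ-cong (λ x → trans (cong (δ (x - c) *_) (sift {F x} (F-periodic (≈-reflexive refl)) d)) (ℤ.*-comm (δ (x - c)) (F x d))) ⟩
      ∑ₚ (λ x → F x d * δ (x - c))
        ≡⟨ sift {λ x → F x d} (λ a≈b → F-periodic a≈b (≈-reflexive refl)) c ⟩
      F c d ∎
      where
      lemma : ∀ f a b → f * (a * b) ≡ a * (f * b)
      lemma = solve-∀

    -- Invertibility is expressed by the adjugate: it inverts the matrix up to the unit determinant.
    ∑²-linear : ∀ {F} → Periodic² F → ∀ a b c d → ¬ P ∣ a * d - b * c →
      ∑² (λ x y → F (a * x + b * y) (c * x + d * y)) ≡ ∑² F
    ∑²-linear {F} F-periodic a b c d p∤det with inverse (a * d - b * c) p∤det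
    ... | e , ∣⇒≈ e≈ = begin
      ∑² (λ x y → F (a * x + b * y) (c * x + d * y))
        ≡⟨ ∑²-cong (λ x y → sym (sift² F-periodic (a * x + b * y) (c * x + d * y))) ⟩
      (∑² λ x y → ∑² λ z w → F z w * δ² (z - (a * x + b * y)) (w - (c * x + d * y)))
        ≡⟨ ∑²-comm (λ x y z w → F z w * δ² (z - (a * x + b * y)) (w - (c * x + d * y))) ⟩
      (∑² λ z w → ∑² λ x y → F z w * δ² (z - (a * x + b * y)) (w - (c * x + d * y)))
        ≡⟨ ∑²-cong (λ z w → ∑²-cong λ x y → cong (F z w *_) (δ²-⇔ (⇒ x y z w) (⇐ x y z w))) ⟩
      (∑² λ z w → ∑² λ x y → F z w * δ² (x - e * (d * z - b * w)) (y - e * (a * w - c * z)))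
        ≡⟨ ∑²-cong (λ z w → sift² {λ _ _ → F z w} (λ _ _ → refl) (e * (d * z - b * w)) (e * (a * w - c * z))) ⟩
      ∑² F ∎
      where
      det = a * d - b * c
      ⇒ : ∀ x y z w → P ∣ z - (a * x + b * y) × P ∣ w - (c * x + d * y) → P ∣ x - e * (d * z - b * w) × P ∣ y - e * (a * w - c * z)
      ⇒ x y z w (z≈ , w≈) =
        ∣-combination 1ℤ (- x) (∣-combination (- (e * d)) (e * b) z≈ w≈ refl) e≈ (lemma₁ a b c d e x y z w) ,
        ∣-combination 1ℤ (- y) (∣-combination (e * c) (- (e * a)) z≈ w≈ refl) e≈ (lemma₂ a b c d e x y z w)
        where
        lemma₁ : ∀ a b c d e x y z w → x - e * (d * z - b * w) ≡
          1ℤ * (- (e * d) * (z - (a * x + b * y)) + e * b * (w - (c * x + d * y))) + - x * (e * (a * d - b * c) - 1ℤ)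
        lemma₁ = solve-∀
        lemma₂ : ∀ a b c d e x y z w → y - e * (a * w - c * z) ≡
          1ℤ * (e * c * (z - (a * x + b * y)) + - (e * a) * (w - (c * x + d * y))) + - y * (e * (a * d - b * c) - 1ℤ)
        lemma₂ = solve-∀
      ⇐ : ∀ x y z w → P ∣ x - e * (d * z - b * w) × P ∣ y - e * (a * w - c * z) → P ∣ z - (a * x + b * y) × P ∣ w - (c * x + d * y)
      ⇐ x y z w (x≈ , y≈) =
        ∣-combination 1ℤ (- z) (∣-combination (- a) (- b) x≈ y≈ refl) e≈ (lemma₁ a b c d e x y z w) ,
        ∣-combination 1ℤ (- w) (∣-combination (- c) (- d) x≈ y≈ refl) e≈ (lemma₂ a b c d e x y z w)
        where
        lemma₁ : ∀ a b c d e x y z w → z - (a * x + b * y) ≡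
          1ℤ * (- a * (x - e * (d * z - b * w)) + - b * (y - e * (a * w - c * z))) + - z * (e * (a * d - b * c) - 1ℤ)
        lemma₁ = solve-∀
        lemma₂ : ∀ a b c d e x y z w → w - (c * x + d * y) ≡
          1ℤ * (- c * (x - e * (d * z - b * w)) + - d * (y - e * (a * w - c * z))) + - w * (e * (a * d - b * c) - 1ℤ)
        lemma₂ = solve-∀

  -- The quadratic character

  module QuadraticCharacter
    (p : ℕ) (p-prime : Prime p) (p∤2 : ¬ + p ∣ + 2) (√-1 : ℤ) (√-1-square : + p ∣ √-1 * √-1 + 1ℤ) where

    open Residues p p-prime
    open _≈_

    ∑ₚ-almost-constant : ∀ (f : ℤ → ℤ) c → Periodic f → (∀ x → ¬ P ∣ x → f x ≡ c) →
      ∑ₚ f ≡ f 0ℤ + (P - 1ℤ) * c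
    ∑ₚ-almost-constant f c f-periodic f≡c = begin
      ∑ₚ f                                                      ≡⟨ ∑ₚ-cong split ⟩
      ∑ₚ (λ x → c + (f 0ℤ - c) * δ (x - 0ℤ))                    ≡⟨ ∑-distrib-+ {p} (λ _ → c) (λ i → (f 0ℤ - c) * δ (ι i - 0ℤ)) ⟩
      ∑ₚ (λ _ → c) + ∑ₚ (λ x → (f 0ℤ - c) * δ (x - 0ℤ))         ≡⟨ cong₂ _+_ (sum-const p c) (sift {λ _ → f 0ℤ - c} (λ _ → refl) 0ℤ) ⟩
      P * c + (f 0ℤ - c)                                        ≡⟨ lemma P c (f 0ℤ) ⟩
      f 0ℤ + (P - 1ℤ) * c                                       ∎
      where
      lemma : ∀ q c z → q * c + (z - c) ≡ z + (q - 1ℤ) * c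
      lemma = solve-∀
      lemma₁ : ∀ c z → z ≡ c + (z - c) * 1ℤ
      lemma₁ = solve-∀
      lemma₂ : ∀ c z → c ≡ c + (z - c) * 0ℤ
      lemma₂ = solve-∀
      split : ∀ x → f x ≡ c + (f 0ℤ - c) * δ (x - 0ℤ)
      split x with P ∣? x
      ... | yes p∣x = trans (f-periodic x≈0) (trans (lemma₁ c (f 0ℤ)) (cong (λ d → c + (f 0ℤ - c) * d) (sym (δ-∣ (≈⇒∣ x≈0)))))
        where
        x≈0 : x ≈ 0ℤ
        x≈0 = ∣⇒≈ (∣-≡ p∣x (ℤ.+-identityʳ x))
      ... | no p∤x = trans (f≡c x p∤x) (trans (lemma₂ c (f 0ℤ)) (cong (λ d → c + (f 0ℤ - c) * d)
        (sym (δ-∤ λ p∣ → p∤x (∣-≡ p∣ (sym (ℤ.+-identityʳ x)))))))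

    opaque
      -- The quadratic character as the number of square roots minus one: its periodicity is then
      -- immediate, and its sum and its behaviour under squares follow by counting roots.
      χ : ℤ → ℤ
      χ a = ∑ₚ (λ x → δ (x * x - a)) - 1ℤ

      χ-def : ∀ a → χ a ≡ ∑ₚ (λ x → δ (x * x - a)) - 1ℤ
      χ-def a = refl

      χ-count : ∀ {a n} → ∑ₚ (λ x → δ (x * x - a)) ≡ n → χ a ≡ n - 1ℤ
      χ-count = cong (λ s → s - 1ℤ)

    χ-periodic : Periodic χ
    χ-periodic {a} {b} a≈b = trans
      (χ-count (∑ₚ-cong λ x → δ-periodic (+-≈ (≈-reflexive {x * x} refl) (-‿≈ a≈b)))) (sym (χ-def b))

    data Quadratic (a : ℤ) : Set where
      null      : P ∣ a → Quadratic a
      square    : ∀ s → ¬ P ∣ s → s * s ≈ a → Quadratic a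
      nonsquare : (∀ s → ¬ s * s ≈ a) → Quadratic a

    opaque
      root? : ∀ a → Dec (∃ λ s → s * s ≈ a)
      root? a = map′ (λ (i , i²≈a) → ι i , ∣⇒≈ i²≈a)
        (λ (s , s²≈a) → residue s , ≈⇒∣ (≈-trans (*-≈ (ι-residue s) (ι-residue s)) s²≈a))
        (Fin.any? λ i → P ∣? ι i * ι i - a)

    quadratic : ∀ a → Quadratic a
    quadratic a with root? a
    ... | no ¬root = nonsquare λ s s²≈a → ¬root (s , s²≈a)
    ... | yes (s , s²≈a) with P ∣? s
    ...   | yes p∣s = null (∣-resp-≈ s²≈a (∣m⇒∣m*n s p∣s))
    ...   | no  p∤s = square s p∤s s²≈a

    nonsquare⇒∤ : ∀ {a} → (∀ s → ¬ s * s ≈ a) → ¬ P ∣ a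
    nonsquare⇒∤ {a} ns p∣a = ns 0ℤ (∣⇒≈ (∣-≡ (∣m⇒∣-m p∣a) (ℤ.+-identityˡ (- a))))

    χ-∣ : ∀ {a} → P ∣ a → χ a ≡ 0ℤ
    χ-∣ {a} p∣a = χ-count (begin
      ∑ₚ (λ x → δ (x * x - a))  ≡⟨ ∑ₚ-cong (λ x → δ-⇔ (to x) (from x)) ⟩
      ∑ₚ (λ x → δ (x - 0ℤ))     ≡⟨ ∑ₚδ≡1 0ℤ ⟩
      1ℤ                        ∎)
      where
      to : ∀ x → P ∣ x * x - a → P ∣ x - 0ℤ
      to x p∣ = ∣-≡ (Sum.[ (λ d → d) , (λ d → d) ]′ (euclid x x (∣m+n∣n⇒∣m p∣ (∣m⇒∣-m p∣a)))) (ℤ.+-identityʳ x)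
      from : ∀ x → P ∣ x - 0ℤ → P ∣ x * x - a
      from x p∣x-0 = ∣m∣n⇒∣m-n (∣n⇒∣m*n x (∣-≡ p∣x-0 (sym (ℤ.+-identityʳ x)))) p∣a

    opaque
      ≈-± : ∀ {s t} → s * s ≈ t * t → s ≈ t ⊎ s ≈ - t
      ≈-± {s} {t} (∣⇒≈ p∣) = Sum.map ∣⇒≈ ∣⇒≈ (euclid (s - t) (s - - t) (∣-≡ p∣ (lemma s t)))
        where
        lemma : ∀ s t → (s - t) * (s - - t) ≡ s * s - t * t
        lemma = solve-∀

    -- The roots are `s` and `- s`, distinct because `p` divides neither 2 nor `s`.
    χ-square : ∀ {a} s → ¬ P ∣ s → s * s ≈ a → χ a ≡ 1ℤ
    χ-square {a} s p∤s s²≈a = χ-count (begin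
      ∑ₚ (λ x → δ (x * x - a))                              ≡⟨ ∑ₚ-cong split ⟩
      ∑ₚ (λ x → δ (x - s) + δ (x - - s))                    ≡⟨ ∑-distrib-+ {p} (λ i → δ (ι i - s)) (λ i → δ (ι i - - s)) ⟩
      ∑ₚ (λ x → δ (x - s)) + ∑ₚ (λ x → δ (x - - s))         ≡⟨ cong₂ _+_ (∑ₚδ≡1 s) (∑ₚδ≡1 (- s)) ⟩
      1ℤ + 1ℤ                                               ∎)
      where
      s≉-s : ¬ s ≈ - s
      s≉-s (∣⇒≈ p∣) with euclid (+ 2) s (∣-≡ p∣ (lemma s))
        where
        lemma : ∀ s → + 2 * s ≡ s - - s
        lemma = solve-∀
      ... | inj₁ p∣2 = p∤2 p∣2
      ... | inj₂ p∣s = p∤s p∣s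
      neg² : ∀ s → - s * - s ≡ s * s
      neg² = solve-∀
      split : ∀ x → δ (x * x - a) ≡ δ (x - s) + δ (x - - s)
      split x with P ∣? x - s | P ∣? x - - s
      ... | yes x≈s | yes x≈-s = contradiction (≈-trans (≈-sym (∣⇒≈ {x} {s} x≈s)) (∣⇒≈ {x} { - s} x≈-s)) s≉-s
      ... | yes x≈s | no  x≉-s = trans (δ-∣ (≈⇒∣ (≈-trans (*-≈ (∣⇒≈ {x} {s} x≈s) (∣⇒≈ {x} {s} x≈s)) s²≈a)))
        (sym (cong₂ _+_ (δ-∣ x≈s) (δ-∤ x≉-s)))
      ... | no  x≉s | yes x≈-s = trans
        (δ-∣ (≈⇒∣ (≈-trans (≈-trans (*-≈ (∣⇒≈ {x} { - s} x≈-s) (∣⇒≈ {x} { - s} x≈-s)) (≈-reflexive (neg² s))) s²≈a)))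
        (sym (cong₂ _+_ (δ-∤ x≉s) (δ-∣ x≈-s)))
      ... | no  x≉s | no  x≉-s = trans (δ-∤ λ p∣ → Sum.[ x≉s ∘ ≈⇒∣ , x≉-s ∘ ≈⇒∣ ]′ (≈-± {x} {s} (≈-trans (∣⇒≈ p∣) (≈-sym s²≈a))))
        (sym (cong₂ _+_ (δ-∤ x≉s) (δ-∤ x≉-s)))

    χ-nonsquare : ∀ {a} → (∀ s → ¬ s * s ≈ a) → χ a ≡ -1ℤ
    χ-nonsquare {a} ns = χ-count
      (trans (∑ₚ-cong λ x → δ-∤ (ns x ∘ ∣⇒≈)) (sum-replicate-zero p))

    χ-unit : ∀ {a} → ¬ P ∣ a → χ a ≡ 1ℤ ⊎ χ a ≡ -1ℤ
    χ-unit {a} p∤a with quadratic a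
    ... | null p∣a        = contradiction p∣a p∤a
    ... | square s p∤s eq = inj₁ (χ-square s p∤s eq)
    ... | nonsquare ns    = inj₂ (χ-nonsquare ns)

    χ-unit² : ∀ {a} → ¬ P ∣ a → χ a * χ a ≡ 1ℤ
    χ-unit² p∤a = Sum.[ (λ eq → cong₂ _*_ eq eq) , (λ eq → cong₂ _*_ eq eq) ]′ (χ-unit p∤a)

    -- Substituting `s * x` for `x` matches the roots of `b` with those of `s * s * b`.
    χ-square-* : ∀ s b → ¬ P ∣ s → χ (s * s * b) ≡ χ b
    χ-square-* s b p∤s = trans (χ-count (begin
      ∑ₚ f                                          ≡⟨ ∑ₚ-scale f-periodic s p∤s ⟨
      ∑ₚ (λ x → f (s * x))                          ≡⟨ ∑ₚ-cong (λ x → δ-⇔ (to x) (from x)) ⟩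
      ∑ₚ (λ x → δ (x * x - b))                      ∎)) (sym (χ-def b))
      where
      f : ℤ → ℤ
      f x = δ (x * x - s * s * b)
      f-periodic : Periodic f
      f-periodic x≈y = δ-periodic (+-≈ (*-≈ x≈y x≈y) (≈-reflexive refl))
      lemma : ∀ x → s * x * (s * x) - s * s * b ≡ s * (s * (x * x - b))
      lemma = identity′ s b
        where
        identity′ : ∀ s b x → s * x * (s * x) - s * s * b ≡ s * (s * (x * x - b))
        identity′ = solve-∀
      to : ∀ x → P ∣ s * x * (s * x) - s * s * b → P ∣ x * x - b
      to x p∣ = ∣-cancelˡ s _ p∤s (∣-cancelˡ s _ p∤s (∣-≡ p∣ (sym (lemma x))))
      from : ∀ x → P ∣ x * x - b → P ∣ s * x * (s * x) - s * s * b
      from x p∣ = ∣-≡ (∣n⇒∣m*n s (∣n⇒∣m*n s p∣)) (lemma x)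

    -- Every `x` is a root of exactly one residue, so the root counts add up to `p`, and 1 is
    -- subtracted `p` times.
    ∑ₚχ≡0 : ∑ₚ χ ≡ 0ℤ
    ∑ₚχ≡0 = begin
      ∑ₚ χ
        ≡⟨ ∑ₚ-cong χ-def ⟩
      ∑ₚ (λ a → ∑ₚ (λ x → δ (x * x - a)) - 1ℤ)
        ≡⟨ ∑-distrib-- {p} (λ i → ∑ₚ (λ x → δ (x * x - ι i))) (λ _ → 1ℤ) ⟩
      ∑ₚ (λ a → ∑ₚ (λ x → δ (x * x - a))) - ∑ₚ (λ _ → 1ℤ)
        ≡⟨ cong (λ s → s - ∑ₚ (λ _ → 1ℤ)) (begin
           ∑ₚ (λ a → ∑ₚ (λ x → δ (x * x - a)))  ≡⟨ ∑ₚ-comm (λ a x → δ (x * x - a)) ⟩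
           ∑ₚ (λ x → ∑ₚ (λ a → δ (x * x - a)))  ≡⟨ ∑ₚ-cong (λ x → ∑ₚ-cong λ a → δ-⇔ (flip (x * x) a) (flip a (x * x))) ⟩
           ∑ₚ (λ x → ∑ₚ (λ a → δ (a - x * x)))  ≡⟨ ∑ₚ-cong (λ x → ∑ₚδ≡1 (x * x)) ⟩
           ∑ₚ (λ _ → 1ℤ)                        ∎) ⟩
      ∑ₚ (λ _ → 1ℤ) - ∑ₚ (λ _ → 1ℤ)
        ≡⟨ ℤ.+-inverseʳ (∑ₚ λ _ → 1ℤ) ⟩
      0ℤ ∎
      where
      flip : ∀ a b → P ∣ a - b → P ∣ b - a
      flip a b p∣ = ≈⇒∣ (≈-sym (∣⇒≈ {a} {b} p∣))

    -- Multiplication by g sends squares to nonsquares, so χ (g a) + χ a ≤ 0 everywhere; these numbers sum to zero.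
    χ-nonsquare-* : ∀ g → (∀ s → ¬ s * s ≈ g) → ∀ b → χ (g * b) ≡ - χ b
    χ-nonsquare-* g ns b = begin
      χ (g * b)           ≡⟨ χ-periodic (*-≈ (≈-reflexive {g} refl) (≈-sym (ι-residue b))) ⟩
      χ (g * ι (residue b)) ≡⟨ lemma (χ (g * ι (residue b))) (χ (ι (residue b))) ⟩
      - χ (ι (residue b)) - f (ι (residue b)) ≡⟨ cong (λ t → - χ (ι (residue b)) - t)
        (sum-nonneg-zero (f ∘ ι) (f≥0 ∘ ι) ∑f≡0 (residue b)) ⟩
      - χ (ι (residue b)) - 0ℤ ≡⟨ ℤ.+-identityʳ _ ⟩
      - χ (ι (residue b)) ≡⟨ cong -_ (χ-periodic (ι-residue b)) ⟩
      - χ b               ∎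
      where
      f : ℤ → ℤ
      f a = - (χ (g * a) + χ a)
      lemma : ∀ x y → x ≡ - y - - (x + y)
      lemma = solve-∀
      ∑f≡0 : ∑ₚ f ≡ 0ℤ
      ∑f≡0 = begin
        ∑ₚ f                                   ≡⟨ sum-neg {p} (λ i → χ (g * ι i) + χ (ι i)) ⟩
        - ∑ₚ (λ a → χ (g * a) + χ a)           ≡⟨ cong -_ (∑-distrib-+ {p} (λ i → χ (g * ι i)) (χ ∘ ι)) ⟩
        - (∑ₚ (λ a → χ (g * a)) + ∑ₚ χ)        ≡⟨ cong (λ s → - (s + ∑ₚ χ)) (∑ₚ-scale χ-periodic g (nonsquare⇒∤ ns)) ⟩
        - (∑ₚ χ + ∑ₚ χ)                        ≡⟨ cong (λ s → - (s + s)) ∑ₚχ≡0 ⟩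
        0ℤ                                     ∎
      g*square : ∀ a s → ¬ P ∣ s → s * s ≈ a → ∀ t → ¬ t * t ≈ g * a
      g*square a s p∤s (∣⇒≈ s²≈a) t (∣⇒≈ t²≈ga) with inverse s p∤s
      ... | u , ∣⇒≈ us≈1 = ns (u * t) (∣⇒≈ (∣-combination 1ℤ (- (u * u) * g)
          (∣-combination (u * u) (g * (u * s + 1ℤ)) t²≈ga us≈1 refl) s²≈a (identity′ g a s t u)))
        where
        identity′ : ∀ g a s t u → u * t * (u * t) - g ≡
          1ℤ * (u * u * (t * t - g * a) + g * (u * s + 1ℤ) * (u * s - 1ℤ)) + - (u * u) * g * (s * s - a)
        identity′ = solve-∀
      f≥0 : ∀ a → 0ℤ ≤ f a
      f≥0 a with quadratic a
      ... | null p∣a = ℤ.≤-reflexive (sym (cong -_ (cong₂ _+_ (χ-∣ (∣n⇒∣m*n g p∣a)) (χ-∣ p∣a))))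
      ... | square s p∤s eq = ℤ.≤-reflexive (sym (cong -_ (cong₂ _+_ (χ-nonsquare (g*square a s p∤s eq)) (χ-square s p∤s eq))))
      -- Whether `g * a` is a square is not yet known here. Since `χ a = -1`, both possible values
      -- of `χ (g * a)` keep `f a` nonnegative.
      ... | nonsquare ns′ with χ-unit (∤-* g a (nonsquare⇒∤ ns) (nonsquare⇒∤ ns′))
      ...   | inj₁ eq = ℤ.≤-reflexive (sym (cong -_ (cong₂ _+_ eq (χ-nonsquare ns′))))
      ...   | inj₂ eq = subst (0ℤ ≤_) (sym (cong -_ (cong₂ _+_ eq (χ-nonsquare ns′)))) (+≤+ ℕ.z≤n)

    χ-* : ∀ a b → χ (a * b) ≡ χ a * χ b
    χ-* a b with quadratic a
    ... | null p∣a = trans (χ-∣ (∣m⇒∣m*n b p∣a)) (sym (trans (cong (_* χ b) (χ-∣ p∣a)) (ℤ.*-zeroˡ (χ b))))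
    ... | square s p∤s s²≈a = begin
      χ (a * b)      ≡⟨ χ-periodic (*-≈ (≈-sym s²≈a) (≈-reflexive {b} refl)) ⟩
      χ (s * s * b)  ≡⟨ χ-square-* s b p∤s ⟩
      χ b            ≡⟨ ℤ.*-identityˡ (χ b) ⟨
      1ℤ * χ b       ≡⟨ cong (_* χ b) (χ-square s p∤s s²≈a) ⟨
      χ a * χ b      ∎
    ... | nonsquare ns = begin
      χ (a * b)   ≡⟨ χ-nonsquare-* a ns b ⟩
      - χ b       ≡⟨ ℤ.-1*i≡-i (χ b) ⟨
      -1ℤ * χ b   ≡⟨ cong (_* χ b) (χ-nonsquare ns) ⟨
      χ a * χ b   ∎

    χ-1 : χ 1ℤ ≡ 1ℤ
    χ-1 = χ-square 1ℤ p∤1 (≈-reflexive refl)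

    χ-neg : ∀ a → χ (- a) ≡ χ a
    χ-neg a = begin
      χ (- a)         ≡⟨ cong χ (ℤ.-1*i≡-i a) ⟨
      χ (-1ℤ * a)     ≡⟨ χ-* -1ℤ a ⟩
      χ -1ℤ * χ a     ≡⟨ cong (_* χ a) (χ-square √-1 p∤√-1 (∣⇒≈ √-1-square)) ⟩
      1ℤ * χ a        ≡⟨ ℤ.*-identityˡ (χ a) ⟩
      χ a             ∎
      where
      p∤√-1 : ¬ P ∣ √-1
      p∤√-1 p∣ = p∤1 (∣m+n∣m⇒∣n √-1-square (∣n⇒∣m*n √-1 p∣))

    opaque
      -- Otherwise `χ` would be nonnegative with sum zero, hence zero everywhere, against
      -- `χ 1ℤ ≡ 1ℤ`.
      nonresidue : ∃ λ g → ∀ s → ¬ s * s ≈ g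
      nonresidue with Fin.any? (λ i → ¬? (root? (ι i)))
      ... | yes (i , ¬root) = ι i , λ s s²≈i → ¬root (s , s²≈i)
      ... | no all-roots = contradiction (trans (sym χ-1) χ1≡0) λ ()
        where
        χ≥0 : ∀ i → 0ℤ ≤ χ (ι i)
        χ≥0 i with quadratic (ι i)
        ... | null p∣i = ℤ.≤-reflexive (sym (χ-∣ p∣i))
        ... | square s p∤s eq = subst (0ℤ ≤_) (sym (χ-square s p∤s eq)) (+≤+ ℕ.z≤n)
        ... | nonsquare ns = contradiction (i , λ (s , eq) → ns s eq) all-roots
        χ1≡0 : χ 1ℤ ≡ 0ℤ
        χ1≡0 = trans (χ-periodic (≈-sym (ι-residue 1ℤ))) (sum-nonneg-zero (χ ∘ ι) χ≥0 ∑ₚχ≡0 (residue 1ℤ))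

    opaque
      -- A quartic character on the squares, extended by zero: well defined because χ is even.
      θ : ℤ → ℤ
      θ a with root? a
      ... | yes (s , _) = χ s
      ... | no _        = 0ℤ

      θ-square : ∀ {a} s → s * s ≈ a → θ a ≡ χ s
      θ-square {a} s s²≈a with root? a
      ... | no ¬root = contradiction (s , s²≈a) ¬root
      ... | yes (t , t²≈a) = Sum.[ χ-periodic , (λ t≈-s → trans (χ-periodic t≈-s) (χ-neg s)) ]′
        (≈-± (≈-trans t²≈a (≈-sym s²≈a)))

      θ-nonsquare : ∀ {a} → (∀ s → ¬ s * s ≈ a) → θ a ≡ 0ℤ
      θ-nonsquare {a} ns with root? a
      ... | yes (s , s²≈a) = contradiction s²≈a (ns s)
      ... | no _ = refl

      θ-periodic : Periodic θ
      θ-periodic {a} {b} a≈b with root? b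
      ... | yes (s , s²≈b) = θ-square s (≈-trans s²≈b (≈-sym a≈b))
      ... | no ¬root = θ-nonsquare (λ s s²≈a → ¬root (s , ≈-trans s²≈a a≈b))

      θ-square-* : ∀ s a → ¬ P ∣ s → θ (s * s * a) ≡ χ s * θ a
      θ-square-* s a p∤s with root? a
      ... | yes (t , t²≈a) = trans (θ-square (s * t)
        (≈-trans (≈-reflexive (lemma s t)) (*-≈ (≈-reflexive {s * s} refl) t²≈a))) (χ-* s t)
        where
        lemma : ∀ s t → s * t * (s * t) ≡ s * s * (t * t)
        lemma = solve-∀
      ... | no ¬root = trans (θ-nonsquare ns) (sym (ℤ.*-zeroʳ (χ s)))
        where
        ns : ∀ t → ¬ t * t ≈ s * s * a
        ns t (∣⇒≈ t²≈) with inverse s p∤s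
        ... | u , ∣⇒≈ us≈1 = ¬root (u * t , ∣⇒≈ (∣-combination (u * u) (a * (u * s + 1ℤ)) t²≈ us≈1 (lemma a s t u)))
          where
          lemma : ∀ a s t u → u * t * (u * t) - a ≡ u * u * (t * t - s * s * a) + a * (u * s + 1ℤ) * (u * s - 1ℤ)
          lemma = solve-∀

  -- The Paley conference matrix

  module PaleyMatrix
    (p : ℕ) (p-prime : Prime p) (p∤2 : ¬ + p ∣ + 2) (√-1 : ℤ) (√-1-square : + p ∣ √-1 * √-1 + 1ℤ) where

    open Residues p p-prime
    open QuadraticCharacter p p-prime p∤2 √-1 √-1-square
    open _≈_

    det : ℤ → ℤ → ℤ → ℤ → ℤ
    det x y u v = x * v - y * u

    -- Homogeneous coordinates on the projective line: `zero` is the point at infinity (1 : 0), and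
    -- `suc t` is the affine point (t : 1).
    X Y : Fin (suc p) → ℤ
    X zero    = 1ℤ
    X (suc t) = ι t
    Y zero    = 0ℤ
    Y (suc t) = 1ℤ

    -- A function homogeneous of degree 0 is constant on the `P - 1` nonzero multiples of each
    -- point, and these multiples exhaust the nonzero vectors.
    projective-sum : ∀ {G} → Periodic² G → (∀ s x y → ¬ P ∣ s → G (s * x) (s * y) ≡ G x y) → G 0ℤ 0ℤ ≡ 0ℤ →
      ∑² G ≡ (P - 1ℤ) * ∑[ l < suc p ] G (X l) (Y l)
    projective-sum {G} G-periodic G-scale G00≡0 = begin
      ∑² G                                    ≡⟨ ∑ₚ-comm G ⟩
      ∑ₚ row                                  ≡⟨ ∑ₚ-almost-constant row (∑ₚ λ t → G t 1ℤ) row-periodic affine ⟩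
      row 0ℤ + (P - 1ℤ) * ∑ₚ (λ t → G t 1ℤ)   ≡⟨ cong (λ s → s + (P - 1ℤ) * ∑ₚ (λ t → G t 1ℤ)) row0 ⟩
      0ℤ + (P - 1ℤ) * G 1ℤ 0ℤ + (P - 1ℤ) * ∑ₚ (λ t → G t 1ℤ)
                                              ≡⟨ lemma (P - 1ℤ) (G 1ℤ 0ℤ) (∑ₚ λ t → G t 1ℤ) ⟩
      (P - 1ℤ) * (G 1ℤ 0ℤ + ∑ₚ (λ t → G t 1ℤ)) ∎
      where
      row : ℤ → ℤ
      row y = ∑ₚ λ x → G x y
      row-periodic : Periodic row
      row-periodic a≈b = ∑ₚ-cong λ x → G-periodic (≈-reflexive {x} refl) a≈b
      lemma : ∀ q a b → 0ℤ + q * a + q * b ≡ q * (a + b)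
      lemma = solve-∀
      affine : ∀ y → ¬ P ∣ y → row y ≡ ∑ₚ λ t → G t 1ℤ
      affine y p∤y = begin
        ∑ₚ (λ x → G x y)               ≡⟨ ∑ₚ-scale {λ x → G x y} (λ a≈b → G-periodic a≈b (≈-reflexive {y} refl)) y p∤y ⟨
        ∑ₚ (λ t → G (y * t) y)         ≡⟨ ∑ₚ-cong (λ t → cong (G (y * t)) (ℤ.*-identityʳ y)) ⟨
        ∑ₚ (λ t → G (y * t) (y * 1ℤ))  ≡⟨ ∑ₚ-cong (λ t → G-scale y t 1ℤ p∤y) ⟩
        ∑ₚ (λ t → G t 1ℤ)              ∎
      row0 : row 0ℤ ≡ 0ℤ + (P - 1ℤ) * G 1ℤ 0ℤ
      row0 = begin
        ∑ₚ (λ x → G x 0ℤ)                ≡⟨ ∑ₚ-almost-constant (λ x → G x 0ℤ) (G 1ℤ 0ℤ)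
          (λ a≈b → G-periodic a≈b (≈-reflexive {0ℤ} refl)) infinite ⟩
        G 0ℤ 0ℤ + (P - 1ℤ) * G 1ℤ 0ℤ     ≡⟨ cong (λ s → s + (P - 1ℤ) * G 1ℤ 0ℤ) G00≡0 ⟩
        0ℤ + (P - 1ℤ) * G 1ℤ 0ℤ          ∎
        where
        infinite : ∀ x → ¬ P ∣ x → G x 0ℤ ≡ G 1ℤ 0ℤ
        infinite x p∤x = trans (cong₂ G (sym (ℤ.*-identityʳ x)) (sym (ℤ.*-zeroʳ x))) (G-scale x 1ℤ 0ℤ p∤x)

    det-periodic : ∀ x y {u v u′ v′} → u ≈ u′ → v ≈ v′ → det x y u v ≈ det x y u′ v′
    det-periodic x y u≈ v≈ = +-≈ (*-≈ (≈-reflexive {x} refl) v≈) (-‿≈ (*-≈ (≈-reflexive {y} refl) u≈))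

    χ-det-periodic : ∀ x y → Periodic² (λ u v → χ (det x y u v))
    χ-det-periodic x y u≈ v≈ = χ-periodic (det-periodic x y u≈ v≈)

    χ-det-scale : ∀ x y s u v → χ (det x y (s * u) (s * v)) ≡ χ s * χ (det x y u v)
    χ-det-scale x y s u v = trans (cong χ (lemma x y s u v)) (χ-* s (det x y u v))
      where
      lemma : ∀ x y s u v → x * (s * v) - y * (s * u) ≡ s * (x * v - y * u)
      lemma = solve-∀

    χ-det-00 : ∀ x y → χ (det x y 0ℤ 0ℤ) ≡ 0ℤ
    χ-det-00 x y = χ-∣ (divides 0ℤ (lemma x y))
      where
      lemma : ∀ x y → x * 0ℤ - y * 0ℤ ≡ 0ℤ
      lemma = solve-∀

    det-∤ : ∀ i j → i ≢ j → ¬ P ∣ det (X i) (Y i) (X j) (Y j)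
    det-∤ zero    zero    i≢j p∣ = i≢j refl
    det-∤ zero    (suc t) i≢j p∣ = p∤1 p∣
    det-∤ (suc t) zero    i≢j p∣ = p∤1 (∣-multiple -1ℤ p∣ (lemma (ι t)))
      where
      lemma : ∀ t → 1ℤ ≡ -1ℤ * (t * 0ℤ - 1ℤ * 1ℤ)
      lemma = solve-∀
    det-∤ (suc t) (suc u) i≢j p∣ = i≢j (cong suc (ι-injective (∣⇒≈ (∣-≡ p∣ (lemma (ι t) (ι u))))))
      where
      lemma : ∀ t u → t - u ≡ t * 1ℤ - 1ℤ * u
      lemma = solve-∀

    det-diagonal : ∀ x y → P ∣ det x y x y
    det-diagonal x y = divides 0ℤ (lemma x y)
      where
      lemma : ∀ x y → x * y - y * x ≡ 0ℤ
      lemma = solve-∀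

    C : Matrix (suc p)
    C i j = χ (det (X i) (Y i) (X j) (Y j))

    C-symmetric : ∀ i j → C i j ≡ C j i
    C-symmetric i j = trans (cong χ (lemma (X i) (Y i) (X j) (Y j))) (χ-neg (det (X j) (Y j) (X i) (Y i)))
      where
      lemma : ∀ x y u v → x * v - y * u ≡ - (u * y - v * x)
      lemma = solve-∀

    C-diagonal : ∀ i → C i i ≡ 0ℤ
    C-diagonal i = χ-∣ (det-diagonal (X i) (Y i))

    C-off-diagonal : ∀ i j → i ≢ j → C i j ≡ 1ℤ ⊎ C i j ≡ -1ℤ
    C-off-diagonal i j i≢j = χ-unit (det-∤ i j i≢j)

    C-square : ∀ i j → C i j * C i j ≡ 1ℤ - identity (suc p) i j
    C-square i j with i Fin.≟ j
    ... | yes refl = cong₂ _*_ (C-diagonal i) (C-diagonal i)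
    ... | no i≢j   = χ-unit² (det-∤ i j i≢j)

    P-1≢0 : ℤ.NonZero (P - 1ℤ)
    P-1≢0 = ℤ.≢-nonZero λ P-1≡0 → p∤1 (∣-≡ ∣-refl (sym (ℤ.i-j≡0⇒i≡j P 1ℤ P-1≡0)))

    -- On the diagonal, a row has `p` entries ±1. For distinct points, pass to the sum over the
    -- plane: the determinants against the two points are then linear coordinates, and in these the
    -- sum is the square of the vanishing sum of `χ`.
    C-orthogonal : ∀ i j → ∑[ l < suc p ] (C i l * C j l) ≡ P * identity (suc p) i j
    C-orthogonal i j with i Fin.≟ j
    ... | yes refl = begin
      ∑[ l < suc p ] (C i l * C i l)                         ≡⟨ sum-cong-≗ (C-square i) ⟩
      ∑[ l < suc p ] (1ℤ - identity (suc p) i l)             ≡⟨ ∑-distrib-- (λ _ → 1ℤ) (identity (suc p) i) ⟩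
      ∑[ l < suc p ] 1ℤ - sum (identity (suc p) i)           ≡⟨ cong₂ _-_ (sum-const (suc p) 1ℤ) (sum-identity (suc p) i) ⟩
      (1ℤ + P) * 1ℤ - 1ℤ                                     ≡⟨ lemma P ⟩
      P * 1ℤ                                                 ∎
      where
      lemma : ∀ q → (1ℤ + q) * 1ℤ - 1ℤ ≡ q * 1ℤ
      lemma = solve-∀
    ... | no i≢j = trans (ℤ.*-cancelˡ-≡ (P - 1ℤ) _ 0ℤ {{P-1≢0}}
        (trans (sym (projective-sum G-periodic G-scale G00)) (trans ∑G≡0 (sym (ℤ.*-zeroʳ (P - 1ℤ))))))
      (sym (ℤ.*-zeroʳ P))
      where
      G : ℤ → ℤ → ℤ
      G u v = χ (det (X i) (Y i) u v) * χ (det (X j) (Y j) u v)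
      G-periodic : Periodic² G
      G-periodic u≈ v≈ = cong₂ _*_ (χ-det-periodic (X i) (Y i) u≈ v≈) (χ-det-periodic (X j) (Y j) u≈ v≈)
      G-scale : ∀ s u v → ¬ P ∣ s → G (s * u) (s * v) ≡ G u v
      G-scale s u v p∤s = begin
        G (s * u) (s * v)             ≡⟨ cong₂ _*_ (χ-det-scale (X i) (Y i) s u v) (χ-det-scale (X j) (Y j) s u v) ⟩
        (χ s * a) * (χ s * b)         ≡⟨ lemma (χ s) a b ⟩
        (χ s * χ s) * (a * b)         ≡⟨ cong (_* (a * b)) (χ-unit² p∤s) ⟩
        1ℤ * (a * b)                  ≡⟨ ℤ.*-identityˡ (a * b) ⟩
        G u v                         ∎
        where
        a = χ (det (X i) (Y i) u v)
        b = χ (det (X j) (Y j) u v)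
        lemma : ∀ c a b → (c * a) * (c * b) ≡ (c * c) * (a * b)
        lemma = solve-∀
      G00 : G 0ℤ 0ℤ ≡ 0ℤ
      G00 = trans (cong (_* χ (det (X j) (Y j) 0ℤ 0ℤ)) (χ-det-00 (X i) (Y i))) (ℤ.*-zeroˡ (χ (det (X j) (Y j) 0ℤ 0ℤ)))
      ∑G≡0 : ∑² G ≡ 0ℤ
      ∑G≡0 = begin
        ∑² G
          ≡⟨ ∑²-cong (λ u v → cong₂ (λ a b → χ a * χ b) (lemma (X i) (Y i) u v) (lemma (X j) (Y j) u v)) ⟩
        ∑² (λ u v → χ (- Y i * u + X i * v) * χ (- Y j * u + X j * v))
          ≡⟨ ∑²-linear (λ a≈ b≈ → cong₂ _*_ (χ-periodic a≈) (χ-periodic b≈)) (- Y i) (X i) (- Y j) (X j)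
               (λ p∣ → det-∤ i j i≢j (∣-≡ p∣ (lemma₂ (X i) (Y i) (X j) (Y j)))) ⟩
        ∑² (λ a b → χ a * χ b)
          ≡⟨ ∑ₚ-cong (λ a → sym (*-distribˡ-∑ₚ (χ a) χ)) ⟩
        ∑ₚ (λ a → χ a * ∑ₚ χ)
          ≡⟨ ∑ₚ-cong (λ a → trans (cong (χ a *_) ∑ₚχ≡0) (ℤ.*-zeroʳ (χ a))) ⟩
        ∑ₚ (λ _ → 0ℤ)
          ≡⟨ sum-replicate-zero p ⟩
        0ℤ ∎
        where
        lemma : ∀ x y u v → x * v - y * u ≡ - y * u + x * v
        lemma = solve-∀
        lemma₂ : ∀ x y u v → x * v - y * u ≡ - y * u - x * - v
        lemma₂ = solve-∀

    -- Row sums of the Paley matrix weighted through the norm form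

    module Twist (g : ℤ) (g-nonsquare : ∀ s → ¬ s * s ≈ g) where

      N : ℤ → ℤ → ℤ
      N x y = x * x - g * (y * y)

      N-periodic : ∀ {u v u′ v′} → u ≈ u′ → v ≈ v′ → N u v ≈ N u′ v′
      N-periodic u≈ v≈ = +-≈ (*-≈ u≈ u≈) (-‿≈ (*-≈ (≈-reflexive {g} refl) (*-≈ v≈ v≈)))

      N-∤ : ∀ l → ¬ P ∣ N (X l) (Y l)
      N-∤ zero    p∣ = p∤1 (∣-≡ p∣ (lemma g))
        where
        lemma : ∀ g → 1ℤ ≡ 1ℤ * 1ℤ - g * (0ℤ * 0ℤ)
        lemma = solve-∀
      N-∤ (suc t) p∣ = g-nonsquare (ι t) (∣⇒≈ (∣-≡ p∣ (lemma (ι t) g)))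
        where
        lemma : ∀ t g → t * t - g ≡ t * t - g * (1ℤ * 1ℤ)
        lemma = solve-∀

      -- Scaling a vector by `s` multiplies `χ` of a determinant by `χ s` and the weight of its norm
      -- by `χ s` as well. The two signs cancel, so the product of the two factors depends only on
      -- the projective point.
      record Weight (τ : ℤ → ℤ) : Set where
        field
          periodic : Periodic τ
          scale    : ∀ s a → ¬ P ∣ s → τ (s * s * a) ≡ χ s * τ a

      -- The sign of the special representative of v: `θ₁` at N v is χ(s) if N v = s², where v / s
      -- has norm 1; `θ₂` is χ(s) if g N v = s², where v / s has norm 1/g. Each vanishes on units of
      -- the other kind.
      θ₁ θ₂ : ℤ → ℤ
      θ₁ = θ
      θ₂ a = θ (g * a)

      θ₁-weight : Weight θ₁
      θ₁-weight = record { periodic = θ-periodic ; scale = θ-square-* }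

      θ₂-weight : Weight θ₂
      θ₂-weight = record
        { periodic = λ a≈b → θ-periodic (*-≈ (≈-reflexive {g} refl) a≈b)
        ; scale    = λ s a p∤s → trans (cong θ (lemma g s a)) (θ-square-* s (g * a) p∤s)
        }
        where
        lemma : ∀ g s a → g * (s * s * a) ≡ s * s * (g * a)
        lemma = solve-∀

      T : (ℤ → ℤ) → ℤ → ℤ → ℤ
      T τ x y = ∑[ l < suc p ] (χ (det x y (X l) (Y l)) * τ (N (X l) (Y l)))

      S : (ℤ → ℤ) → ℤ → ℤ → ℤ
      S τ x y = ∑² λ u v → χ (det x y u v) * τ (N u v)

      S≡T : ∀ {τ} → Weight τ → ∀ x y → S τ x y ≡ (P - 1ℤ) * T τ x y
      S≡T {τ} τ-weight x y = projective-sum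
        (λ u≈ v≈ → cong₂ _*_ (χ-det-periodic x y u≈ v≈) (periodic (N-periodic u≈ v≈)))
        scaled
        (trans (cong (_* τ (N 0ℤ 0ℤ)) (χ-det-00 x y)) (ℤ.*-zeroˡ (τ (N 0ℤ 0ℤ))))
        where
        open Weight τ-weight
        scaled : ∀ s u v → ¬ P ∣ s →
          χ (det x y (s * u) (s * v)) * τ (N (s * u) (s * v)) ≡ χ (det x y u v) * τ (N u v)
        scaled s u v p∤s = begin
          χ (det x y (s * u) (s * v)) * τ (N (s * u) (s * v))
            ≡⟨ cong₂ _*_ (χ-det-scale x y s u v) (trans (cong τ (lemma g s u v)) (scale s (N u v) p∤s)) ⟩
          (χ s * a) * (χ s * b)   ≡⟨ lemma₂ (χ s) a b ⟩
          (χ s * χ s) * (a * b)   ≡⟨ cong (_* (a * b)) (χ-unit² p∤s) ⟩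
          1ℤ * (a * b)            ≡⟨ ℤ.*-identityˡ (a * b) ⟩
          a * b                   ∎
          where
          a = χ (det x y u v)
          b = τ (N u v)
          lemma : ∀ g s u v → (s * u) * (s * u) - g * ((s * v) * (s * v)) ≡ s * s * (u * u - g * (v * v))
          lemma = solve-∀
          lemma₂ : ∀ c a b → (c * a) * (c * b) ≡ (c * c) * (a * b)
          lemma₂ = solve-∀

      -- Multiplication by z = x + y√g in F_p(√g) multiplies N by N z and the determinant by N z as well.
      S-rotate : ∀ {τ} → Weight τ → ∀ x y → ¬ P ∣ N x y →
        S τ x y ≡ χ (N x y) * ∑² λ u v → χ (det 1ℤ 0ℤ u v) * τ (N x y * N u v)
      S-rotate {τ} τ-weight x y p∤N = begin
        S τ x y
          ≡⟨ ∑²-linear {F} F-periodic x (g * y) y x (λ p∣ → p∤N (∣-≡ p∣ (lemma g x y))) ⟨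
        ∑² (λ u v → χ (det x y (x * u + g * y * v) (y * u + x * v)) * τ (N (x * u + g * y * v) (y * u + x * v)))
          ≡⟨ ∑²-cong (λ u v → cong₂ (λ a b → χ a * τ b) (lemma₁ g x y u v) (lemma₂ g x y u v)) ⟩
        ∑² (λ u v → χ (N x y * det 1ℤ 0ℤ u v) * τ (N x y * N u v))
          ≡⟨ ∑²-cong (λ u v → trans (cong (_* τ (N x y * N u v)) (χ-* (N x y) (det 1ℤ 0ℤ u v)))
               (ℤ.*-assoc (χ (N x y)) (χ (det 1ℤ 0ℤ u v)) (τ (N x y * N u v)))) ⟩
        ∑² (λ u v → χ (N x y) * (χ (det 1ℤ 0ℤ u v) * τ (N x y * N u v)))
          ≡⟨ *-distribˡ-∑² (χ (N x y)) (λ u v → χ (det 1ℤ 0ℤ u v) * τ (N x y * N u v)) ⟨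
        χ (N x y) * ∑² (λ u v → χ (det 1ℤ 0ℤ u v) * τ (N x y * N u v)) ∎
        where
        open Weight τ-weight
        F : ℤ → ℤ → ℤ
        F u v = χ (det x y u v) * τ (N u v)
        F-periodic : Periodic² F
        F-periodic u≈ v≈ = cong₂ _*_ (χ-det-periodic x y u≈ v≈) (periodic (N-periodic u≈ v≈))
        lemma : ∀ g x y → x * x - g * (y * y) ≡ x * x - g * y * y
        lemma = solve-∀
        lemma₁ : ∀ g x y u v → x * (y * u + x * v) - y * (x * u + g * y * v) ≡ (x * x - g * (y * y)) * (1ℤ * v - 0ℤ * u)
        lemma₁ = solve-∀
        lemma₂ : ∀ g x y u v → (x * u + g * y * v) * (x * u + g * y * v) - g * ((y * u + x * v) * (y * u + x * v)) ≡
          (x * x - g * (y * y)) * (u * u - g * (v * v))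
        lemma₂ = solve-∀

      S-transform : ∀ {τ τ′} → Weight τ → ∀ x y c → ¬ P ∣ N x y → (∀ a → χ (N x y) * τ (N x y * a) ≡ c * τ′ a) →
        S τ x y ≡ c * S τ′ 1ℤ 0ℤ
      S-transform {τ} {τ′} τ-weight x y c p∤N eq = begin
        S τ x y
          ≡⟨ S-rotate τ-weight x y p∤N ⟩
        χ (N x y) * ∑² (λ u v → χ (det 1ℤ 0ℤ u v) * τ (N x y * N u v))
          ≡⟨ *-distribˡ-∑² (χ (N x y)) (λ u v → χ (det 1ℤ 0ℤ u v) * τ (N x y * N u v)) ⟩
        ∑² (λ u v → χ (N x y) * (χ (det 1ℤ 0ℤ u v) * τ (N x y * N u v)))
          ≡⟨ ∑²-cong (λ u v → trans (swap (χ (N x y)) (χ (det 1ℤ 0ℤ u v)) (τ (N x y * N u v)))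
               (trans (cong (χ (det 1ℤ 0ℤ u v) *_) (eq (N u v))) (swap (χ (det 1ℤ 0ℤ u v)) c (τ′ (N u v))))) ⟩
        ∑² (λ u v → c * (χ (det 1ℤ 0ℤ u v) * τ′ (N u v)))
          ≡⟨ *-distribˡ-∑² c (λ u v → χ (det 1ℤ 0ℤ u v) * τ′ (N u v)) ⟨
        c * S τ′ 1ℤ 0ℤ ∎
        where
        swap : ∀ a b c → a * (b * c) ≡ b * (a * c)
        swap = solve-∀

      -- Multiplication by x + y√g carries (1 : 0) to (x : y) and replaces `τ a` by `τ (N x y * a)`
      -- in the sum. If this rescaled weight is again a multiple of a weight, the row at (x : y) is
      -- known from the row at (1 : 0).
      T-transform : ∀ {τ τ′} → Weight τ → Weight τ′ → ∀ x y c → ¬ P ∣ N x y →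
        (∀ a → χ (N x y) * τ (N x y * a) ≡ c * τ′ a) → T τ x y ≡ c * T τ′ 1ℤ 0ℤ
      T-transform {τ} {τ′} τ-weight τ′-weight x y c p∤N eq = ℤ.*-cancelˡ-≡ (P - 1ℤ) _ _ {{P-1≢0}} (begin
        (P - 1ℤ) * T τ x y              ≡⟨ S≡T τ-weight x y ⟨
        S τ x y                         ≡⟨ S-transform τ-weight x y c p∤N eq ⟩
        c * S τ′ 1ℤ 0ℤ                  ≡⟨ cong (c *_) (S≡T τ′-weight 1ℤ 0ℤ) ⟩
        c * ((P - 1ℤ) * T τ′ 1ℤ 0ℤ)     ≡⟨ lemma c (P - 1ℤ) (T τ′ 1ℤ 0ℤ) ⟩
        (P - 1ℤ) * (c * T τ′ 1ℤ 0ℤ)     ∎)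
        where
        lemma : ∀ a b c → a * (b * c) ≡ b * (a * c)
        lemma = solve-∀

      a₁ a₂ : Fin (suc p) → ℤ
      a₁ l = θ₁ (N (X l) (Y l))
      a₂ l = θ₂ (N (X l) (Y l))

      α β : ℤ
      α = T θ₁ 1ℤ 0ℤ
      β = T θ₂ 1ℤ 0ℤ

      T₁ T₂ : Fin (suc p) → ℤ
      T₁ i = T θ₁ (X i) (Y i)
      T₂ i = T θ₂ (X i) (Y i)

      -- The two kinds of points, with ε = χ(s) for a root s of the norm n or of g n. A nonsquare n
      -- exchanges the weights. In passing from `θ₁` to `θ₂`, the factor χ(n) = χ(g) is absorbed by
      -- scaling with g²; in passing back, χ(n) = -1 remains, which is the one minus sign.
      data Class (i : Fin (suc p)) : Set where
        first  : ∀ ε → ε ≡ 1ℤ ⊎ ε ≡ -1ℤ → a₁ i ≡ ε → a₂ i ≡ 0ℤ → T₁ i ≡ ε * α → T₂ i ≡ ε * β → Class i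
        second : ∀ ε → ε ≡ 1ℤ ⊎ ε ≡ -1ℤ → a₁ i ≡ 0ℤ → a₂ i ≡ ε → T₁ i ≡ ε * β → T₂ i ≡ - ε * α → Class i

      χ≡-1⇒nonsquare : ∀ {a} → χ a ≡ -1ℤ → ∀ s → ¬ s * s ≈ a
      χ≡-1⇒nonsquare {a} χa≡-1 s s²≈a with P ∣? s
      ... | yes p∣s = contradiction (trans (sym χa≡-1) (χ-∣ (∣-resp-≈ s²≈a (∣m⇒∣m*n s p∣s)))) λ ()
      ... | no  p∤s = contradiction (trans (sym χa≡-1) (χ-square s p∤s s²≈a)) λ ()

      classify : ∀ i → Class i
      classify i with quadratic (N (X i) (Y i))
      ... | null p∣ = contradiction p∣ (N-∤ i)
      ... | square s p∤s s²≈N = first (χ s) (χ-unit p∤s)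
          (θ-square s s²≈N)
          (θ-nonsquare (χ≡-1⇒nonsquare (trans (χ-nonsquare-* g g-nonsquare n) (cong -_ χn≡1))))
          (T-transform {θ₁} {θ₁} θ₁-weight θ₁-weight (X i) (Y i) (χ s) (N-∤ i) (rule θ₁-weight))
          (T-transform {θ₂} {θ₂} θ₂-weight θ₂-weight (X i) (Y i) (χ s) (N-∤ i) (rule θ₂-weight))
        where
        n = N (X i) (Y i)
        χn≡1 : χ n ≡ 1ℤ
        χn≡1 = χ-square s p∤s s²≈N
        rule : ∀ {τ} → Weight τ → ∀ a → χ n * τ (n * a) ≡ χ s * τ a
        rule {τ} τ-weight a = begin
          χ n * τ (n * a)        ≡⟨ cong₂ _*_ χn≡1 (periodic (*-≈ (≈-sym s²≈N) (≈-reflexive {a} refl))) ⟩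
          1ℤ * τ (s * s * a)     ≡⟨ ℤ.*-identityˡ _ ⟩
          τ (s * s * a)          ≡⟨ scale s a p∤s ⟩
          χ s * τ a              ∎
          where open Weight τ-weight
      ... | nonsquare n-nonsquare = helper (quadratic (g * n))
        where
        n = N (X i) (Y i)
        χn≡-1 : χ n ≡ -1ℤ
        χn≡-1 = χ-nonsquare n-nonsquare
        χgn≡1 : χ (g * n) ≡ 1ℤ
        χgn≡1 = trans (χ-nonsquare-* g g-nonsquare n) (cong -_ χn≡-1)
        helper : Quadratic (g * n) → Class i
        helper (null p∣)      = contradiction (trans (sym χgn≡1) (χ-∣ p∣)) λ ()
        helper (nonsquare ns) = contradiction (trans (sym χgn≡1) (χ-nonsquare ns)) λ ()
        helper (square s p∤s s²≈gn) = second (χ s) (χ-unit p∤s)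
          (θ-nonsquare n-nonsquare)
          (θ-square s s²≈gn)
          (T-transform {θ₁} {θ₂} θ₁-weight θ₂-weight (X i) (Y i) (χ s) (N-∤ i) rule₁)
          (T-transform {θ₂} {θ₁} θ₂-weight θ₁-weight (X i) (Y i) (- χ s) (N-∤ i) rule₂)
          where
          rule₂ : ∀ a → χ n * θ (g * (n * a)) ≡ - χ s * θ a
          rule₂ a = begin
            χ n * θ (g * (n * a))   ≡⟨ cong₂ _*_ χn≡-1 (cong θ (sym (ℤ.*-assoc g n a))) ⟩
            -1ℤ * θ (g * n * a)     ≡⟨ cong (-1ℤ *_) (θ-periodic (*-≈ (≈-sym s²≈gn) (≈-reflexive {a} refl))) ⟩
            -1ℤ * θ (s * s * a)     ≡⟨ cong (-1ℤ *_) (θ-square-* s a p∤s) ⟩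
            -1ℤ * (χ s * θ a)       ≡⟨ lemma (χ s) (θ a) ⟩
            - χ s * θ a             ∎
            where
            lemma : ∀ a b → -1ℤ * (a * b) ≡ - a * b
            lemma = solve-∀
          rule₁ : ∀ a → χ n * θ (n * a) ≡ χ s * θ (g * a)
          rule₁ a = begin
            -- Both `n` and `g` are nonsquares, so `χ n` may be traded for `χ g`, which `θ` absorbs
            -- as the factor `g * g`.
            χ n * θ (n * a)         ≡⟨ cong (_* θ (n * a)) (trans χn≡-1 (sym (χ-nonsquare g-nonsquare))) ⟩
            χ g * θ (n * a)         ≡⟨ θ-square-* g (n * a) (nonsquare⇒∤ g-nonsquare) ⟨
            θ (g * g * (n * a))     ≡⟨ cong θ (lemma g n a) ⟩
            θ (g * n * (g * a))     ≡⟨ θ-periodic (*-≈ (≈-sym s²≈gn) (≈-reflexive {g * a} refl)) ⟩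
            θ (s * s * (g * a))     ≡⟨ θ-square-* s (g * a) p∤s ⟩
            χ s * θ (g * a)         ∎
            where
            lemma : ∀ g n a → g * g * (n * a) ≡ g * n * (g * a)
            lemma = solve-∀

      -- Both classes in one formula: `C` maps the vector `a₁` to the combination of `a₁` and `a₂`
      -- with coefficients `α` and `β`, so `C` can be applied once more.
      T₁-combination : ∀ i → T₁ i ≡ a₁ i * α + a₂ i * β
      T₁-combination i with classify i
      ... | first  ε _ a₁≡ a₂≡ T₁≡ _ = trans T₁≡ (trans (lemma ε α β) (sym (cong₂ (λ a b → a * α + b * β) a₁≡ a₂≡)))
        where
        lemma : ∀ ε α β → ε * α ≡ ε * α + 0ℤ * β
        lemma = solve-∀
      ... | second ε _ a₁≡ a₂≡ T₁≡ _ = trans T₁≡ (trans (lemma ε α β) (sym (cong₂ (λ a b → a * α + b * β) a₁≡ a₂≡)))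
        where
        lemma : ∀ ε α β → ε * β ≡ 0ℤ * α + ε * β
        lemma = solve-∀

      -- Apply `C` twice to `a₁` and read off the entry at (1 : 0), where `a₁` is 1. The combination
      -- formula gives the left side, and orthogonality of the symmetric matrix `C` gives `P`.
      α²+β²≡P : α * α + β * β ≡ P
      α²+β²≡P = begin
        α * α + β * β
          ≡⟨ cong₂ _+_ (*-distribʳ-sum α (λ l → C zero l * a₁ l)) (*-distribʳ-sum β (λ l → C zero l * a₂ l)) ⟩
        ∑[ l < suc p ] (C zero l * a₁ l * α) + ∑[ l < suc p ] (C zero l * a₂ l * β)
          ≡⟨ ∑-distrib-+ (λ l → C zero l * a₁ l * α) (λ l → C zero l * a₂ l * β) ⟨
        ∑[ l < suc p ] (C zero l * a₁ l * α + C zero l * a₂ l * β)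
          ≡⟨ sum-cong-≗ (λ l → trans (lemma (C zero l) (a₁ l) (a₂ l) α β) (cong (C zero l *_) (sym (T₁-combination l)))) ⟩
        ∑[ l < suc p ] (C zero l * T₁ l)
          ≡⟨ sum-cong-≗ (λ l → *-distribˡ-sum (C zero l) (λ k → C l k * a₁ k)) ⟩
        ∑[ l < suc p ] ∑[ k < suc p ] (C zero l * (C l k * a₁ k))
          ≡⟨ ∑-comm (λ l k → C zero l * (C l k * a₁ k)) ⟩
        ∑[ k < suc p ] ∑[ l < suc p ] (C zero l * (C l k * a₁ k))
          ≡⟨ sum-cong-≗ (λ k → trans (sum-cong-≗ λ l →
               trans (cong (λ c → C zero l * (c * a₁ k)) (C-symmetric l k)) (lemma₂ (C zero l) (C k l) (a₁ k)))
               (trans (sym (*-distribˡ-sum (a₁ k) (λ l → C zero l * C k l))) (cong (a₁ k *_) (C-orthogonal zero k)))) ⟩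
        ∑[ k < suc p ] (a₁ k * (P * identity (suc p) zero k))
          ≡⟨ sum-cong-≗ (λ k → lemma₃ (a₁ k) P (identity (suc p) zero k)) ⟩
        ∑[ k < suc p ] (P * a₁ k * identity (suc p) zero k)
          ≡⟨ sum-*-identity (suc p) zero (λ k → P * a₁ k) ⟩
        P * a₁ zero
          ≡⟨ cong (P *_) (trans (θ-square 1ℤ (≈-reflexive (lemma₄ g))) χ-1) ⟩
        P * 1ℤ
          ≡⟨ ℤ.*-identityʳ P ⟩
        P ∎
        where
        lemma : ∀ c a b α β → c * a * α + c * b * β ≡ c * (a * α + b * β)
        lemma = solve-∀
        lemma₂ : ∀ c d a → c * (d * a) ≡ a * (c * d)
        lemma₂ = solve-∀
        lemma₃ : ∀ a q e → a * (q * e) ≡ q * a * e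
        lemma₃ = solve-∀
        lemma₄ : ∀ g → 1ℤ * 1ℤ ≡ 1ℤ * 1ℤ - g * (0ℤ * 0ℤ)
        lemma₄ = solve-∀

      a : Fin (suc p) → ℤ
      a l = a₁ l + a₂ l

      a-unit : ∀ i → a i ≡ 1ℤ ⊎ a i ≡ -1ℤ
      a-unit i with classify i
      ... | first  ε ε±1 a₁≡ a₂≡ _ _ = subst (λ e → e ≡ 1ℤ ⊎ e ≡ -1ℤ) (sym (trans (cong₂ _+_ a₁≡ a₂≡) (ℤ.+-identityʳ ε))) ε±1
      ... | second ε ε±1 a₁≡ a₂≡ _ _ = subst (λ e → e ≡ 1ℤ ⊎ e ≡ -1ℤ) (sym (trans (cong₂ _+_ a₁≡ a₂≡) (ℤ.+-identityˡ ε))) ε±1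

      SignedSumOrDifference : ℤ → Set
      SignedSumOrDifference r = ∃ λ ε → (ε ≡ 1ℤ ⊎ ε ≡ -1ℤ) × (r ≡ ε * (α + β) ⊎ r ≡ ε * (β - α))

      opaque
        C-row : ∀ i → SignedSumOrDifference (∑[ l < suc p ] (C i l * a l))
        C-row i = by-class (classify i)
          where
          row : ∑[ l < suc p ] (C i l * a l) ≡ T₁ i + T₂ i
          row = trans (sum-cong-≗ λ l → ℤ.*-distribˡ-+ (C i l) (a₁ l) (a₂ l)) (∑-distrib-+ (λ l → C i l * a₁ l) (λ l → C i l * a₂ l))
          lemma : ∀ ε α β → ε * α + ε * β ≡ ε * (α + β)
          lemma = solve-∀
          lemma₂ : ∀ ε α β → ε * β + - ε * α ≡ ε * (β - α)
          lemma₂ = solve-∀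
          by-class : Class i → SignedSumOrDifference (∑[ l < suc p ] (C i l * a l))
          by-class (first ε ε±1 _ _ T₁≡ T₂≡) = ε , ε±1 , inj₁ (trans row (trans (cong₂ _+_ T₁≡ T₂≡) (lemma ε α β)))
          by-class (second ε ε±1 _ _ T₁≡ T₂≡) = ε , ε±1 , inj₂ (trans row (trans (cong₂ _+_ T₁≡ T₂≡) (lemma₂ ε α β)))

  -- Squares and parity

  ≢0⇒square≥1 : ∀ i → i ≢ 0ℤ → 1ℤ ≤ i * i
  ≢0⇒square≥1 +0       i≢0 = contradiction refl i≢0
  ≢0⇒square≥1 +[1+ n ] i≢0 = +≤+ (ℕ.s≤s ℕ.z≤n)
  ≢0⇒square≥1 -[1+ n ] i≢0 = +≤+ (ℕ.s≤s ℕ.z≤n)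

  sum-of-squares≡1 : ∀ a b → a * a + b * b ≡ 1ℤ → (a * a ≡ 1ℤ × b ≡ 0ℤ) ⊎ (a ≡ 0ℤ × b * b ≡ 1ℤ)
  sum-of-squares≡1 a b eq with a ℤ.≟ 0ℤ | b ℤ.≟ 0ℤ
  ... | yes refl | _        = inj₂ (refl , trans (sym (ℤ.+-identityˡ (b * b))) eq)
  ... | no _     | yes refl = inj₁ (trans (sym (ℤ.+-identityʳ (a * a))) eq , refl)
  ... | no a≢0   | no b≢0   with subst (1ℤ + 1ℤ ≤_) eq (ℤ.+-mono-≤ (≢0⇒square≥1 a a≢0) (≢0⇒square≥1 b b≢0))
  ...   | +≤+ (ℕ.s≤s ())

  square≡1 : ∀ a → a * a ≡ 1ℤ → a ≡ 1ℤ ⊎ a ≡ -1ℤ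
  square≡1 a eq with ℤ.i*j≡0⇒i≡0∨j≡0 (a - 1ℤ) {a + 1ℤ} (trans (lemma a) (ℤ.i≡j⇒i-j≡0 eq))
    where
    lemma : ∀ a → (a - 1ℤ) * (a + 1ℤ) ≡ a * a - 1ℤ
    lemma = solve-∀
  ... | inj₁ a-1≡0 = inj₁ (ℤ.i-j≡0⇒i≡j a 1ℤ a-1≡0)
  ... | inj₂ a+1≡0 = inj₂ (ℤ.i-j≡0⇒i≡j a -1ℤ a+1≡0)

  Even Odd : ℤ → Set
  Even a = ∃ λ e → a ≡ + 2 * e
  Odd a  = ∃ λ e → a ≡ 1ℤ + + 2 * e

  even⊎odd : ∀ a → Even a ⊎ Odd a
  even⊎odd a with a %ℕ 2 | n%ℕd<d a 2 | a≡a%ℕn+[a/ℕn]*n a 2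
  ... | 0 | _ | eq = inj₁ (a /ℕ 2 , trans eq (trans (ℤ.+-identityˡ _) (ℤ.*-comm (a /ℕ 2) (+ 2))))
  ... | 1 | _ | eq = inj₂ (a /ℕ 2 , trans eq (cong (_+_ 1ℤ) (ℤ.*-comm (a /ℕ 2) (+ 2))))
  ... | suc (suc _) | ℕ.s≤s (ℕ.s≤s ()) | _

  odd⇒¬even : ∀ {a} → Odd a → ¬ Even a
  odd⇒¬even (e , refl) (f , 1+2e≡2f) = contradiction (ℕ.∣1⇒≡1 (∣⇒∣ᵤ (divides {+ 2} (f - e) 1≡[f-e]*2))) λ ()
    where
    lemma : ∀ e f → 1ℤ ≡ (1ℤ + + 2 * e) - + 2 * f + (f - e) * + 2
    lemma = solve-∀
    1≡[f-e]*2 : 1ℤ ≡ (f - e) * + 2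
    1≡[f-e]*2 = trans (lemma e f) (trans (cong (λ t → t + (f - e) * + 2) (ℤ.i≡j⇒i-j≡0 1+2e≡2f)) (ℤ.+-identityˡ _))

  -- Gaussian integers

  ℤ[i] : Set
  ℤ[i] = ℤ × ℤ

  infixl 7 _⊛_
  _⊛_ : ℤ[i] → ℤ[i] → ℤ[i]
  (a , b) ⊛ (c , d) = a * c - b * d , a * d + b * c

  norm : ℤ[i] → ℤ
  norm (a , b) = a * a + b * b

  infixr 8 _⊛^_
  _⊛^_ : ℤ[i] → ℕ → ℤ[i]
  z ⊛^ zero  = 1ℤ , 0ℤ
  z ⊛^ suc k = z ⊛ z ⊛^ k

  ⊛-assoc : ∀ u v w → (u ⊛ v) ⊛ w ≡ u ⊛ (v ⊛ w)
  ⊛-assoc (a , b) (c , d) (e , f) = cong₂ _,_ (re a b c d e f) (im a b c d e f)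
    where
    re : ∀ a b c d e f → (a * c - b * d) * e - (a * d + b * c) * f ≡ a * (c * e - d * f) - b * (c * f + d * e)
    re = solve-∀
    im : ∀ a b c d e f → (a * c - b * d) * f + (a * d + b * c) * e ≡ a * (c * f + d * e) + b * (c * e - d * f)
    im = solve-∀

  ⊛-identityˡ : ∀ z → (1ℤ , 0ℤ) ⊛ z ≡ z
  ⊛-identityˡ (a , b) = cong₂ _,_ (re a b) (im a b)
    where
    re : ∀ a b → 1ℤ * a - 0ℤ * b ≡ a
    re = solve-∀
    im : ∀ a b → 1ℤ * b + 0ℤ * a ≡ b
    im = solve-∀

  norm-⊛ : ∀ u v → norm (u ⊛ v) ≡ norm u * norm v
  norm-⊛ (a , b) (c , d) = lemma a b c d
    where
    lemma : ∀ a b c d → (a * c - b * d) * (a * c - b * d) + (a * d + b * c) * (a * d + b * c) ≡ (a * a + b * b) * (c * c + d * d)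
    lemma = solve-∀

  ⊛^-+ : ∀ z j k → z ⊛^ (j ℕ.+ k) ≡ z ⊛^ j ⊛ z ⊛^ k
  ⊛^-+ z zero    k = sym (⊛-identityˡ (z ⊛^ k))
  ⊛^-+ z (suc j) k = trans (cong (z ⊛_) (⊛^-+ z j k)) (sym (⊛-assoc z (z ⊛^ j) (z ⊛^ k)))

  ⊛^-double : ∀ z h → z ⊛^ (h ℕ.+ h) ≡ (z ⊛ z) ⊛^ h
  ⊛^-double z zero    = refl
  ⊛^-double z (suc h) = begin
    z ⊛ z ⊛^ (h ℕ.+ suc h)     ≡⟨ cong (λ k → z ⊛ z ⊛^ k) (ℕ.+-suc h h) ⟩
    z ⊛ (z ⊛ z ⊛^ (h ℕ.+ h))   ≡⟨ ⊛-assoc z z _ ⟨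
    (z ⊛ z) ⊛ z ⊛^ (h ℕ.+ h)   ≡⟨ cong ((z ⊛ z) ⊛_) (⊛^-double z h) ⟩
    (z ⊛ z) ⊛ (z ⊛ z) ⊛^ h     ∎

  -- The 2-adic expansion of z = (1 + 2ci)²ʰ to the first order beyond 1; t is the power of 2 dividing h.
  record NearOne (c : ℤ) (z : ℤ[i]) : Set where
    field
      t A B : ℤ
      t≢0   : t ≢ 0ℤ
      A-odd : Odd A
      B-odd : Odd B
      form  : z ≡ (1ℤ + + 4 * (t * (c * c * A)) , + 4 * (t * (c * B)))

  -- The base is (1 + 2ci)². Each further factor raises both normalised coefficients by one up to
  -- even numbers; in the real part it contributes -1 = 1 - 2, whence the summand -1 in `e′`.
  square-expansion : ∀ c h → ∃ λ e → ∃ λ f →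
    (1ℤ - + 4 * (c * c) , + 4 * c) ⊛^ h ≡ (1ℤ + + 4 * (c * c * (+ h + + 2 * e)) , + 4 * (c * (+ h + + 2 * f)))
  square-expansion c zero    = 0ℤ , 0ℤ , cong₂ _,_ (re c) (im c)
    where
    re : ∀ c → 1ℤ ≡ 1ℤ + + 4 * (c * c * 0ℤ)
    re = solve-∀
    im : ∀ c → 0ℤ ≡ + 4 * (c * 0ℤ)
    im = solve-∀
  square-expansion c (suc h) with square-expansion c h
  ... | e , f , eq = e′ , f′ , trans (cong ((1ℤ - + 4 * (c * c) , + 4 * c) ⊛_) eq) (cong₂ _,_ (re c (+ h) e f) (im c (+ h) e f))
    where
    A = + h + + 2 * e
    B = + h + + 2 * f
    e′ = e - 1ℤ - + 2 * (c * c) * A - + 2 * B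
    f′ = f - + 2 * (c * c) * B + + 2 * (c * c) * A
    re : ∀ c h e f → (1ℤ - + 4 * (c * c)) * (1ℤ + + 4 * (c * c * (h + + 2 * e))) - + 4 * c * (+ 4 * (c * (h + + 2 * f))) ≡
      1ℤ + + 4 * (c * c * ((1ℤ + h) + + 2 * (e - 1ℤ - + 2 * (c * c) * (h + + 2 * e) - + 2 * (h + + 2 * f))))
    re = solve-∀
    im : ∀ c h e f → (1ℤ - + 4 * (c * c)) * (+ 4 * (c * (h + + 2 * f))) + + 4 * c * (1ℤ + + 4 * (c * c * (h + + 2 * e))) ≡
      + 4 * (c * ((1ℤ + h) + + 2 * (f - + 2 * (c * c) * (h + + 2 * f) + + 2 * (c * c) * (h + + 2 * e))))
    im = solve-∀

  -- Squaring doubles `t`. The quadratic terms are divisible by 16t², while the new scale is 8t, so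
  -- `A` and `B` change only by even amounts.
  double-NearOne : ∀ c z → NearOne c z → NearOne c (z ⊛ z)
  double-NearOne c z near with NearOne.A-odd near | NearOne.B-odd near
  ... | e , refl | f , refl = record
    { t = + 2 * t ; A = A + + 2 * (t * (c * c * (A * A)) - t * (B * B)) ; B = B * (1ℤ + + 4 * (t * (c * c * A)))
    ; t≢0 = λ 2t≡0 → Sum.[ (λ ()) , t≢0 ]′ (ℤ.i*j≡0⇒i≡0∨j≡0 (+ 2) 2t≡0)
    ; A-odd = e + (t * (c * c * (A * A)) - t * (B * B)) , odd₁ e (t * (c * c * (A * A)) - t * (B * B))
    ; B-odd = f + + 2 * B * (t * (c * c * A)) , odd₂ f (t * (c * c * A))
    ; form = trans (cong (λ u → u ⊛ u) form) (cong₂ _,_ (re t c A B) (im t c A B))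
    }
    where
    open NearOne near using (t; t≢0; form)
    A = 1ℤ + + 2 * e
    B = 1ℤ + + 2 * f
    odd₁ : ∀ e u → 1ℤ + + 2 * e + + 2 * u ≡ 1ℤ + + 2 * (e + u)
    odd₁ = solve-∀
    odd₂ : ∀ f v → (1ℤ + + 2 * f) * (1ℤ + + 4 * v) ≡ 1ℤ + + 2 * (f + + 2 * (1ℤ + + 2 * f) * v)
    odd₂ = solve-∀
    re : ∀ t c A B →
      (1ℤ + + 4 * (t * (c * c * A))) * (1ℤ + + 4 * (t * (c * c * A))) - + 4 * (t * (c * B)) * (+ 4 * (t * (c * B))) ≡
      1ℤ + + 4 * (+ 2 * t * (c * c * (A + + 2 * (t * (c * c * (A * A)) - t * (B * B)))))
    re = solve-∀
    im : ∀ t c A B →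
      (1ℤ + + 4 * (t * (c * c * A))) * (+ 4 * (t * (c * B))) + + 4 * (t * (c * B)) * (1ℤ + + 4 * (t * (c * c * A))) ≡
      + 4 * (+ 2 * t * (c * (B * (1ℤ + + 4 * (t * (c * c * A))))))
    im = solve-∀

  ℕ-parity : ∀ h → (∃ λ k → h ≡ k ℕ.+ k) ⊎ (∃ λ k → h ≡ suc (k ℕ.+ k))
  ℕ-parity zero    = inj₁ (0 , refl)
  ℕ-parity (suc h) with ℕ-parity h
  ... | inj₁ (k , h≡2k)   = inj₂ (k , cong suc h≡2k)
  ... | inj₂ (k , h≡1+2k) = inj₁ (suc k , cong suc (trans h≡1+2k (sym (ℕ.+-suc k k))))

  odd-power : ∀ c k → NearOne c ((1ℤ - + 4 * (c * c) , + 4 * c) ⊛^ suc (k ℕ.+ k))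
  odd-power c k = from-expansion (square-expansion c (suc (k ℕ.+ k)))
    where
    H = + suc (k ℕ.+ k)
    odd : ∀ k e → 1ℤ + (k + k) + + 2 * e ≡ 1ℤ + + 2 * (k + e)
    odd = solve-∀
    from-expansion : (∃ λ e → ∃ λ f → (1ℤ - + 4 * (c * c) , + 4 * c) ⊛^ suc (k ℕ.+ k) ≡
      (1ℤ + + 4 * (c * c * (H + + 2 * e)) , + 4 * (c * (H + + 2 * f)))) → NearOne c ((1ℤ - + 4 * (c * c) , + 4 * c) ⊛^ suc (k ℕ.+ k))
    from-expansion (e , f , eq) = record
      { t = 1ℤ ; A = H + + 2 * e ; B = H + + 2 * f ; t≢0 = λ ()
      ; A-odd = + k + e , odd (+ k) e ; B-odd = + k + f , odd (+ k) f
      ; form = trans eq (cong₂ (λ a b → 1ℤ + + 4 * a , + 4 * b)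
          (sym (ℤ.*-identityˡ (c * c * (H + + 2 * e)))) (sym (ℤ.*-identityˡ (c * (H + + 2 * f)))))
      }

  -- Halve `h` until it is odd: the expansion settles odd exponents, and each doubling is a
  -- squaring.
  power-NearOne : ∀ c h → 0 ℕ.< h → NearOne c ((1ℤ - + 4 * (c * c) , + 4 * c) ⊛^ h)
  power-NearOne c = <-rec _ step
    where
    ζ : ℤ[i]
    ζ = 1ℤ - + 4 * (c * c) , + 4 * c
    step : ∀ h → (∀ {k} → k ℕ.< h → 0 ℕ.< k → NearOne c (ζ ⊛^ k)) → 0 ℕ.< h → NearOne c (ζ ⊛^ h)
    step h rec 0<h with ℕ-parity h
    ... | inj₁ (suc k , refl) = subst (NearOne c) (sym (⊛^-+ ζ (suc k) (suc k)))
      (double-NearOne c (ζ ⊛^ suc k) (rec (ℕ.m<m+n (suc k) (ℕ.s≤s ℕ.z≤n)) (ℕ.s≤s ℕ.z≤n)))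
    ... | inj₁ (zero , refl)  = contradiction 0<h λ ()
    ... | inj₂ (k , refl)     = odd-power c k

  -- For z as in `NearOne`, `r` is the real part of (1 + 2ci)z and equals 1 + 4tc²(A - 2B). Since A
  -- - 2B is odd, the correction is nonzero, so r is not 1; being 1 modulo 4, r is not -1 either.
  1+4u≢±1 : ∀ c t A B → c ≢ 0ℤ → t ≢ 0ℤ → Odd A → let r = 1ℤ + + 4 * (t * (c * c * A)) - + 2 * c * (+ 4 * (t * (c * B))) in
    ¬ r * r ≡ 1ℤ
  1+4u≢±1 c t A B c≢0 t≢0 A-odd r²≡1 = Sum.[ r≢1 , r≢-1 ]′ (square≡1 r r²≡1)
    where
    r = 1ℤ + + 4 * (t * (c * c * A)) - + 2 * c * (+ 4 * (t * (c * B)))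
    u = t * (c * (c * (A - + 2 * B)))
    factor : ∀ t c A B → 1ℤ + + 4 * (t * (c * c * A)) - + 2 * c * (+ 4 * (t * (c * B))) ≡ 1ℤ + + 4 * (t * (c * (c * (A - + 2 * B))))
    factor = solve-∀
    nonzero-* : ∀ a b → a ≢ 0ℤ → b ≢ 0ℤ → a * b ≢ 0ℤ
    nonzero-* a b a≢0 b≢0 ab≡0 = Sum.[ a≢0 , b≢0 ]′ (ℤ.i*j≡0⇒i≡0∨j≡0 a ab≡0)
    u≢0 : u ≢ 0ℤ
    u≢0 = nonzero-* t _ t≢0 (nonzero-* c _ c≢0 (nonzero-* c _ c≢0
      λ A-2B≡0 → odd⇒¬even A-odd (B , ℤ.i-j≡0⇒i≡j A (+ 2 * B) A-2B≡0)))
    r≢1 : r ≢ 1ℤ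
    r≢1 r≡1 = nonzero-* (+ 4) u (λ ()) u≢0 (begin
      + 4 * u                ≡⟨ lemma (+ 4 * u) ⟩
      1ℤ + + 4 * u - 1ℤ      ≡⟨ ℤ.i≡j⇒i-j≡0 (trans (sym (factor t c A B)) r≡1) ⟩
      0ℤ                     ∎)
      where
      lemma : ∀ v → v ≡ 1ℤ + v - 1ℤ
      lemma = solve-∀
    r≢-1 : r ≢ -1ℤ
    r≢-1 r≡-1 = odd⇒¬even (0ℤ , refl) (- u , ℤ.*-cancelˡ-≡ (+ 2) 1ℤ (+ 2 * - u)
      (trans (cong (_-_ 1ℤ) (trans (sym r≡-1) (factor t c A B))) (lemma u)))
      where
      lemma : ∀ u → 1ℤ - (1ℤ + + 4 * u) ≡ + 2 * (+ 2 * - u)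
      lemma = solve-∀

  -- In terms of (1 + 2ci)²ʰ = x + yi this says Re (1 + 2ci)²ʰ⁺¹ ≠ ±1.
  odd-power-re≢±1 : ∀ c h x y → c ≢ 0ℤ → 0 ℕ.< h → (1ℤ - + 4 * (c * c) , + 4 * c) ⊛^ h ≡ (x , y) →
    ¬ (x - + 2 * c * y) * (x - + 2 * c * y) ≡ 1ℤ
  odd-power-re≢±1 c h x y c≢0 0<h eq = excluded (subst (NearOne c) eq (power-NearOne c h 0<h))
    where
    excluded : NearOne c (x , y) → ¬ (x - + 2 * c * y) * (x - + 2 * c * y) ≡ 1ℤ
    excluded record { t = t ; A = A ; B = B ; t≢0 = t≢0 ; A-odd = A-odd ; form = refl } =
      1+4u≢±1 c t A B c≢0 t≢0 A-odd

  -- Lebesgue's theorem for prime bases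

  m*n≡1⇒m²≡1 : ∀ m n → m * n ≡ 1ℤ → m * m ≡ 1ℤ
  m*n≡1⇒m²≡1 m n mn≡1 = by-abs m (ℕ.m*n≡1⇒m≡1 ℤ.∣ m ∣ ℤ.∣ n ∣ (trans (sym (ℤ.abs-* m n)) (cong ℤ.∣_∣ mn≡1)))
    where
    by-abs : ∀ m → ℤ.∣ m ∣ ≡ 1 → m * m ≡ 1ℤ
    by-abs (+ .1)    refl = refl
    by-abs -[1+ .0 ] refl = refl

  -- Applied to π² = (a + 2ci)², whose imaginary part is 4ac: every power of π² has imaginary part
  -- divisible by a, and therefore a divides the real part of π²ʰ⁺¹.
  im-power : ∀ R e h → ∃ λ v → proj₂ ((R , e) ⊛^ h) ≡ e * v
  im-power R e zero    = 0ℤ , sym (ℤ.*-zeroʳ e)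
  im-power R e (suc h) with im-power R e h
  ... | v , im≡ev = R * v + proj₁ ((R , e) ⊛^ h) ,
    trans (cong (λ y → R * y + e * proj₁ ((R , e) ⊛^ h)) im≡ev) (lemma R e v (proj₁ ((R , e) ⊛^ h)))
    where
    lemma : ∀ R e v u → R * (e * v) + e * u ≡ e * (R * v + u)
    lemma = solve-∀

  OneAndMultiple : ℤ → ℤ[i] → Set
  OneAndMultiple x (a , b) = ∃ λ s → ∃ λ t → s * s ≡ 1ℤ × t * t ≡ 1ℤ × ((a ≡ s × b ≡ t * x) ⊎ (a ≡ t * x × b ≡ s))

  unit-multiple : ∀ x y τ w → y ≡ τ * x → τ * τ ≡ 1ℤ → norm w ≡ 1ℤ → OneAndMultiple x ((1ℤ , y) ⊛ w)
  unit-multiple x y τ (k , l) refl τ²≡1 norm-w = by-unit (sum-of-squares≡1 k l norm-w)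
    where
    re₁ : ∀ k τ x → 1ℤ * k - τ * x * 0ℤ ≡ k
    re₁ = solve-∀
    im₁ : ∀ k τ x → 1ℤ * 0ℤ + τ * x * k ≡ τ * k * x
    im₁ = solve-∀
    re₂ : ∀ l τ x → 1ℤ * 0ℤ - τ * x * l ≡ - τ * l * x
    re₂ = solve-∀
    im₂ : ∀ l τ x → 1ℤ * l + τ * x * 0ℤ ≡ l
    im₂ = solve-∀
    square₁ : ∀ τ k → τ * k * (τ * k) ≡ τ * τ * (k * k)
    square₁ = solve-∀
    square₂ : ∀ τ k → - τ * k * (- τ * k) ≡ τ * τ * (k * k)
    square₂ = solve-∀
    by-unit : (k * k ≡ 1ℤ × l ≡ 0ℤ) ⊎ (k ≡ 0ℤ × l * l ≡ 1ℤ) → OneAndMultiple x ((1ℤ , τ * x) ⊛ (k , l))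
    by-unit (inj₁ (k²≡1 , refl)) =
      k , τ * k , k²≡1 , trans (square₁ τ k) (cong₂ _*_ τ²≡1 k²≡1) , inj₁ (re₁ k τ x , im₁ k τ x)
    by-unit (inj₂ (refl , l²≡1)) =
      l , - τ * l , l²≡1 , trans (square₂ τ l) (cong₂ _*_ τ²≡1 l²≡1) , inj₂ (re₂ l τ x , im₂ l τ x)

  -- The Gaussian primes above p

  module GaussianPrime (p : ℕ) (p-prime : Prime p) where

    open Residues p p-prime

    opaque
      -- With π = a + bi and z = x + yi, the numbers ax + by and ay - bx are the parts of z times
      -- the conjugate of π. Their squares add up to N(π)N(z), so `P` divides both, and dividing
      -- them by `P` gives the quotient z / π.
      gaussian-quotient : ∀ a b x y → norm (a , b) ≡ P → P ∣ norm (x , y) → P ∣ a * x + b * y → ∃ λ w → (x , y) ≡ (a , b) ⊛ w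
      gaussian-quotient a b x y norm≡P P∣norm P∣ax+by = helper P∣ax+by (Sum.[ (λ d → d) , (λ d → d) ]′ (euclid _ _ P∣[ay-bx]²))
        where
        lemma : ∀ a b x y → (a * y - b * x) * (a * y - b * x) ≡ (a * a + b * b) * (x * x + y * y) + - (a * x + b * y) * (a * x + b * y)
        lemma = solve-∀
        P∣[ay-bx]² : P ∣ (a * y - b * x) * (a * y - b * x)
        P∣[ay-bx]² = ∣-combination (a * a + b * b) (- (a * x + b * y)) P∣norm P∣ax+by (lemma a b x y)
        re : ∀ a b x y → (a * a + b * b) * x ≡ a * (a * x + b * y) - b * (a * y - b * x)
        re = solve-∀
        im : ∀ a b x y → (a * a + b * b) * y ≡ a * (a * y - b * x) + b * (a * x + b * y)
        im = solve-∀
        re₂ : ∀ q a b k l → a * (k * q) - b * (l * q) ≡ q * (a * k - b * l)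
        re₂ = solve-∀
        im₂ : ∀ q a b k l → a * (l * q) + b * (k * q) ≡ q * (a * l + b * k)
        im₂ = solve-∀
        helper : P ∣ a * x + b * y → P ∣ a * y - b * x → ∃ λ w → (x , y) ≡ (a , b) ⊛ w
        helper (divides k ax+by≡kP) (divides l ay-bx≡lP) = (k , l) , cong₂ _,_
          (ℤ.*-cancelˡ-≡ P x (a * k - b * l) (trans (cong (_* x) (sym norm≡P)) (trans (re a b x y)
            (trans (cong₂ (λ s t → a * s - b * t) ax+by≡kP ay-bx≡lP) (re₂ P a b k l)))))
          (ℤ.*-cancelˡ-≡ P y (a * l + b * k) (trans (cong (_* y) (sym norm≡P)) (trans (im a b x y)
            (trans (cong₂ (λ s t → a * t + b * s) ax+by≡kP ay-bx≡lP) (im₂ P a b k l)))))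

    norm-conjugate : ∀ a b → norm (a , - b) ≡ norm (a , b)
    norm-conjugate = lemma
      where
      lemma : ∀ a b → a * a + - b * - b ≡ a * a + b * b
      lemma = solve-∀

    -- The product (ax + by)(ax - by) = a²(x² + y²) - y²(a² + b²) is divisible by `P`, so Euclid's
    -- lemma in ℤ decides whether π or its conjugate divides.
    gaussian-prime : ∀ a b x y → norm (a , b) ≡ P → P ∣ norm (x , y) →
      (∃ λ w → (x , y) ≡ (a , b) ⊛ w) ⊎ (∃ λ w → (x , y) ≡ (a , - b) ⊛ w)
    gaussian-prime a b x y norm≡P P∣norm = Sum.map
      (gaussian-quotient a b x y norm≡P P∣norm)
      (gaussian-quotient a (- b) x y (trans (norm-conjugate a b) norm≡P) P∣norm)
      (euclid (a * x + b * y) (a * x + - b * y)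
        (∣-combination (a * a) (- (y * y)) P∣norm (∣-≡ ∣-refl norm≡P) (lemma a b x y)))
      where
      lemma : ∀ a b x y → (a * x + b * y) * (a * x + - b * y) ≡ a * a * (x * x + y * y) + - (y * y) * (a * a + b * b)
      lemma = solve-∀

    Primitive : ℤ[i] → Set
    Primitive (x , y) = ¬ (P ∣ x × P ∣ y)

    primitive-⊛ : ∀ u z → Primitive (u ⊛ z) → Primitive z
    primitive-⊛ (a , b) (x , y) prim (P∣x , P∣y) = prim
      (∣m∣n⇒∣m-n (∣n⇒∣m*n a P∣x) (∣n⇒∣m*n b P∣y) , ∣m∣n⇒∣m+n (∣n⇒∣m*n a P∣y) (∣n⇒∣m*n b P∣x))

    conjugate-not-primitive : ∀ a b w → norm (a , b) ≡ P → ¬ Primitive ((a , b) ⊛ ((a , - b) ⊛ w))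
    conjugate-not-primitive a b (x , y) norm≡P prim = prim
      (∣-multiple x (∣-≡ ∣-refl norm≡P) (re a b x y) , ∣-multiple y (∣-≡ ∣-refl norm≡P) (im a b x y))
      where
      re : ∀ a b x y → a * (a * x - - b * y) - b * (a * y + - b * x) ≡ x * (a * a + b * b)
      re = solve-∀
      im : ∀ a b x y → a * (a * y + - b * x) + b * (a * x - - b * y) ≡ y * (a * a + b * b)
      im = solve-∀

    opaque
      norm-quotient : ∀ u z w k → norm u ≡ P → z ≡ u ⊛ w → norm z ≡ + (p ℕ.^ suc k) → norm w ≡ + (p ℕ.^ k)
      norm-quotient u z w k norm-u norm-z≡uw norm-z = ℤ.*-cancelˡ-≡ P _ _ (begin
        P * norm w                ≡⟨ cong (_* norm w) norm-u ⟨
        norm u * norm w           ≡⟨ norm-⊛ u w ⟨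
        norm (u ⊛ w)              ≡⟨ cong norm norm-z≡uw ⟨
        norm z                    ≡⟨ norm-z ⟩
        + (p ℕ.* p ℕ.^ k)         ≡⟨ ℤ.pos-* p (p ℕ.^ k) ⟩
        P * + (p ℕ.^ k)           ∎)

      P∣norm-suc : ∀ z k → norm z ≡ + (p ℕ.^ suc k) → P ∣ norm z
      P∣norm-suc z k eq = divides (+ (p ℕ.^ k)) (trans eq (trans (ℤ.pos-* p (p ℕ.^ k)) (ℤ.*-comm P (+ (p ℕ.^ k)))))

    -- One factor π is kept outside `z`: if the conjugate of π divided `z`, then p would divide π z.
    -- So at every step it is π that splits off.
    primitive-factorisation : ∀ a b → norm (a , b) ≡ P → ∀ k z → norm z ≡ + (p ℕ.^ k) → Primitive ((a , b) ⊛ z) →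
      ∃ λ w → z ≡ (a , b) ⊛^ k ⊛ w × norm w ≡ 1ℤ
    primitive-factorisation a b norm≡P zero    z norm-z prim = z , sym (⊛-identityˡ z) , norm-z
    primitive-factorisation a b norm≡P (suc k) z@(x , y) norm-z prim = Sum.[ divide , conjugate-divides ]′
      (gaussian-prime a b x y norm≡P (P∣norm-suc z k norm-z))
      where
      π = a , b
      conjugate-divides : (∃ λ w → z ≡ (a , - b) ⊛ w) → ∃ λ w → z ≡ π ⊛^ suc k ⊛ w × norm w ≡ 1ℤ
      conjugate-divides (w , z≡) = contradiction (subst (λ z → Primitive (π ⊛ z)) z≡ prim) (conjugate-not-primitive a b w norm≡P)
      extend : ∀ w → z ≡ π ⊛ w → (∃ λ w′ → w ≡ π ⊛^ k ⊛ w′ × norm w′ ≡ 1ℤ) → ∃ λ w → z ≡ π ⊛^ suc k ⊛ w × norm w ≡ 1ℤ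
      extend w z≡ (w′ , w≡ , norm-w′) = w′ , trans z≡ (trans (cong (π ⊛_) w≡) (sym (⊛-assoc π (π ⊛^ k) w′))) , norm-w′
      divide : (∃ λ w → z ≡ π ⊛ w) → ∃ λ w → z ≡ π ⊛^ suc k ⊛ w × norm w ≡ 1ℤ
      divide (w , z≡) = extend w z≡ (primitive-factorisation a b norm≡P k w (norm-quotient π z w k norm≡P z≡ norm-z)
        (subst Primitive z≡ (primitive-⊛ π z prim)))

    opaque
      -- One of 1 + xi and 1 - xi divides a + bi, and the quotient has norm 1, so it is a unit ±1 or
      -- ±i.
      two-squares-unique : ∀ a b x → norm (a , b) ≡ P → norm (1ℤ , x) ≡ P → OneAndMultiple x (a , b)
      two-squares-unique a b x norm-ab norm-1x = Sum.[
          (λ (w , ab≡) → from-quotient x 1ℤ w (sym (ℤ.*-identityˡ x)) refl norm-1x ab≡) ,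
          (λ (w , ab≡) → from-quotient (- x) -1ℤ w (sym (ℤ.-1*i≡-i x)) refl (trans (norm-conjugate 1ℤ x) norm-1x) ab≡)
        ]′ (gaussian-prime 1ℤ x a b norm-1x (∣-≡ ∣-refl norm-ab))
        where
        from-quotient : ∀ y τ w → y ≡ τ * x → τ * τ ≡ 1ℤ → norm (1ℤ , y) ≡ P → (a , b) ≡ (1ℤ , y) ⊛ w → OneAndMultiple x (a , b)
        from-quotient y τ w y≡τx τ²≡1 norm-1y ab≡ = subst (OneAndMultiple x) (sym ab≡)
          (unit-multiple x y τ w y≡τx τ²≡1
            (norm-quotient (1ℤ , y) (a , b) w 0 norm-1y ab≡ (trans norm-ab (cong (+_) (sym (ℕ.*-identityʳ p))))))

    -- If 1 + xi is a unit times π²ʰ⁺¹ with π = a + 2ci, comparing real parts gives a = ±1, so that π = ±(1 ± 2ci).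
    odd-power-contradiction : ∀ a c k l h z → norm (a , + 2 * c) ≡ P → norm (k , l) ≡ 1ℤ → 0 ℕ.< h →
      ((a , + 2 * c) ⊛ (a , + 2 * c)) ⊛^ h ≡ z → proj₁ ((a , + 2 * c) ⊛ (z ⊛ (k , l))) ≢ 1ℤ
    odd-power-contradiction a c k l h (u , v) norm≡P norm-kl≡1 0<h power re≡1 = by-unit (sum-of-squares≡1 k l norm-kl≡1)
      where
      e = a * (+ 2 * c) + (+ 2 * c) * a
      v-multiple : ∃ λ v′ → v ≡ e * v′
      v-multiple with im-power (a * a - + 2 * c * (+ 2 * c)) e h
      ... | v′ , eq = v′ , trans (sym (cong proj₂ power)) eq
      v′ = proj₁ v-multiple
      v≡ev′ : v ≡ e * v′
      v≡ev′ = proj₂ v-multiple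
      re-i : ∀ a c u v′ l →
        a * (u * 0ℤ - (a * (+ 2 * c) + (+ 2 * c) * a) * v′ * l) -
          + 2 * c * (u * l + (a * (+ 2 * c) + (+ 2 * c) * a) * v′ * 0ℤ) ≡
        + 2 * (- a * (a * (+ 2 * c)) * v′ * l - c * u * l)
      re-i = solve-∀
      re-1 : ∀ a c u v′ k →
        a * (u * k - (a * (+ 2 * c) + (+ 2 * c) * a) * v′ * 0ℤ) -
          + 2 * c * (u * 0ℤ + (a * (+ 2 * c) + (+ 2 * c) * a) * v′ * k) ≡
        a * (k * (u - + 8 * (c * c) * v′))
      re-1 = solve-∀
      by-unit : ¬ ((k * k ≡ 1ℤ × l ≡ 0ℤ) ⊎ (k ≡ 0ℤ × l * l ≡ 1ℤ))
      -- With a unit ±i the real part would be even, because 2c and the imaginary part `v` of π²ʰ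
      -- are even.
      by-unit (inj₂ (refl , _)) = odd⇒¬even {1ℤ} (0ℤ , refl) (- a * (a * (+ 2 * c)) * v′ * l - c * u * l , trans (sym re≡1)
        (trans (cong (λ v → a * (u * 0ℤ - v * l) - + 2 * c * (u * l + v * 0ℤ)) v≡ev′) (re-i a c u v′ l)))
      by-unit (inj₁ (k²≡1 , refl)) = odd-power-re≢±1 c₁ h u v c₁≢0 0<h (trans (cong (_⊛^ h) π²) power) square
        where
        -- Since a = ±1, π = a(1 + 2aci), and the sign disappears in π²; thus aci takes the place of
        -- ci in the 2-adic expansion.
        c₁ = a * c
        d = u - + 8 * (c * c) * v′
        akd≡1 : a * (k * d) ≡ 1ℤ
        akd≡1 = trans (sym (trans (cong (λ v → a * (u * k - v * 0ℤ) - + 2 * c * (u * 0ℤ + v * k)) v≡ev′) (re-1 a c u v′ k))) re≡1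
        a²≡1 : a * a ≡ 1ℤ
        a²≡1 = m*n≡1⇒m²≡1 a (k * d) akd≡1
        d²≡1 : d * d ≡ 1ℤ
        d²≡1 = m*n≡1⇒m²≡1 d (a * k) (trans (lemma a k d) akd≡1)
          where
          lemma : ∀ a k d → d * (a * k) ≡ a * (k * d)
          lemma = solve-∀
        d≡ : u - + 2 * c₁ * v ≡ d
        d≡ = trans (cong (λ v → u - + 2 * c₁ * v) v≡ev′) (trans (lemma a c u v′)
          (trans (cong (λ s → u - + 8 * (c * c) * (s * v′)) a²≡1) (cong (λ s → u - + 8 * (c * c) * s) (ℤ.*-identityˡ v′))))
          where
          lemma : ∀ a c u v′ → u - + 2 * (a * c) * ((a * (+ 2 * c) + (+ 2 * c) * a) * v′) ≡ u - + 8 * (c * c) * (a * a * v′)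
          lemma = solve-∀
        square : (u - + 2 * c₁ * v) * (u - + 2 * c₁ * v) ≡ 1ℤ
        square = trans (cong (λ s → s * s) d≡) d²≡1
        π² : (1ℤ - + 4 * (c₁ * c₁) , + 4 * c₁) ≡ (a , + 2 * c) ⊛ (a , + 2 * c)
        π² = cong₂ _,_
          (trans (cong (λ s → s - + 4 * (c₁ * c₁)) (sym a²≡1)) (trans (re₁ a c)
            (trans (cong (λ s → a * a - s * (+ 4 * (c * c))) a²≡1) (re₂ a c))))
          (im a c)
          where
          re₁ : ∀ a c → a * a - + 4 * (a * c * (a * c)) ≡ a * a - a * a * (+ 4 * (c * c))
          re₁ = solve-∀
          re₂ : ∀ a c → a * a - 1ℤ * (+ 4 * (c * c)) ≡ a * a - + 2 * c * (+ 2 * c)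
          re₂ = solve-∀
          im : ∀ a c → + 4 * (a * c) ≡ a * (+ 2 * c) + + 2 * c * a
          im = solve-∀
        c₁≢0 : c₁ ≢ 0ℤ
        c₁≢0 c₁≡0 with ℤ.i*j≡0⇒i≡0∨j≡0 a c₁≡0
        ... | inj₁ refl = contradiction a²≡1 λ ()
        ... | inj₂ refl = p∤1 (∣-≡ ∣-refl (trans (sym a²≡1) (trans (sym (ℤ.+-identityʳ (a * a))) norm≡P)))

    odd-power-impossible : ∀ a c w x h → norm (a , + 2 * c) ≡ P → 0 ℕ.< h → norm (1ℤ , x) ≡ + (p ℕ.^ suc (h ℕ.+ h)) →
      (1ℤ , x) ≢ (a , + 2 * c) ⊛ w
    odd-power-impossible a c w x h norm≡P 0<h norm-1x eq
      with primitive-factorisation a (+ 2 * c) norm≡P (h ℕ.+ h) w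
             (norm-quotient (a , + 2 * c) (1ℤ , x) w (h ℕ.+ h) norm≡P eq norm-1x)
             (subst Primitive eq (p∤1 ∘ proj₁))
    ... | (k , l) , w≡ , norm-kl = odd-power-contradiction a c k l h (((a , + 2 * c) ⊛ (a , + 2 * c)) ⊛^ h) norm≡P norm-kl 0<h refl
        (sym (cong proj₁ (trans eq (cong ((a , + 2 * c) ⊛_) (trans w≡ (cong (_⊛ (k , l)) (⊛^-double (a , + 2 * c) h)))))))

    -- As the norm is odd, `a` and `b` cannot both be odd; an even one is moved to the imaginary
    -- part.
    even-part : ∀ a b → norm (a , b) ≡ P → ¬ + 2 ∣ P → ∃ λ a′ → ∃ λ c → norm (a′ , + 2 * c) ≡ P
    even-part a b norm≡P 2∤P with even⊎odd a | even⊎odd b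
    ... | _              | inj₁ (c , refl) = a , c , norm≡P
    ... | inj₁ (c , refl) | inj₂ _         = b , c , trans (ℤ.+-comm (b * b) _) norm≡P
    ... | inj₂ (e , refl) | inj₂ (f , refl) = contradiction
      (divides (1ℤ + + 2 * e + + 2 * (e * e) + + 2 * f + + 2 * (f * f)) (trans (sym norm≡P) (lemma e f))) 2∤P
      where
      lemma : ∀ e f → (1ℤ + + 2 * e) * (1ℤ + + 2 * e) + (1ℤ + + 2 * f) * (1ℤ + + 2 * f) ≡
        (1ℤ + + 2 * e + + 2 * (e * e) + + 2 * f + + 2 * (f * f)) * + 2
      lemma = solve-∀

    lebesgue : ∀ a b x r → norm (a , b) ≡ P → ¬ + 2 ∣ P → x ≢ 0ℤ → 0 ℕ.< r → norm (1ℤ , x) ≡ + (p ℕ.^ r) → r ≡ 1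
    lebesgue a b x r norm≡P 2∤P x≢0 0<r norm-1x with ℕ-parity r
    ... | inj₂ (zero , refl) = refl
    -- For an even exponent 1 + x² would be a square n², and (n - x)(n + x) = 1 forces x = 0.
    ... | inj₁ (k , refl) = contradiction x≡0 x≢0
      where
      n = + (p ℕ.^ k)
      eq : 1ℤ + x * x ≡ n * n
      eq = trans norm-1x (trans (cong (+_) (ℕ.^-distribˡ-+-* p k k)) (ℤ.pos-* (p ℕ.^ k) (p ℕ.^ k)))
      lemma : ∀ n x → (n - x) * (n + x) ≡ 1ℤ + (n * n - (1ℤ + x * x))
      lemma = solve-∀
      product : (n - x) * (n + x) ≡ 1ℤ
      product = trans (lemma n x) (cong (_+_ 1ℤ) (ℤ.i≡j⇒i-j≡0 (sym eq)))
      lemma₂ : ∀ n x → + 2 * x ≡ 1ℤ * (n + x) - (n - x) * 1ℤ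
      lemma₂ = solve-∀
      lemma₃ : ∀ u v → u * u * v - u * (u * v) ≡ 0ℤ
      lemma₃ = solve-∀
      2x≡0 : + 2 * x ≡ 0ℤ
      2x≡0 = trans (lemma₂ n x) (trans
        (cong₂ (λ s t → s * (n + x) - (n - x) * t) (sym (m*n≡1⇒m²≡1 (n - x) (n + x) product)) (sym product))
        (lemma₃ (n - x) (n + x)))
      x≡0 : x ≡ 0ℤ
      x≡0 = ℤ.*-cancelˡ-≡ (+ 2) x 0ℤ 2x≡0
    ... | inj₂ (h@(suc _) , refl) with even-part a b norm≡P 2∤P
    ...   | a′ , c , norm≡P′ with gaussian-prime a′ (+ 2 * c) 1ℤ x norm≡P′ (P∣norm-suc (1ℤ , x) (h ℕ.+ h) norm-1x)
    ...     | inj₁ (w , eq) = contradiction eq (odd-power-impossible a′ c w x h norm≡P′ (ℕ.s≤s ℕ.z≤n) norm-1x)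
    -- The conjugate prime has the same shape, with `- c` in place of `c`.
    ...     | inj₂ (w , eq) = contradiction (trans eq (cong (λ b → (a′ , b) ⊛ w) (ℤ.neg-distribʳ-* (+ 2) c)))
        (odd-power-impossible a′ (- c) w x h (trans (cong (λ b → norm (a′ , b)) (sym (ℤ.neg-distribʳ-* (+ 2) c)))
          (trans (norm-conjugate a′ (+ 2 * c)) norm≡P′)) (ℕ.s≤s ℕ.z≤n) norm-1x)

  -- Excess of conference matrices

  column-sum : ∀ {n} → Matrix n → Fin n → ℤ
  column-sum {n} W j = ∑[ i < n ] W i j

  excess≡∑column-sum : ∀ {n} (W : Matrix n) → excess W ≡ sum (column-sum W)
  excess≡∑column-sum W = ∑-comm W

  module _ {n} {W : Matrix n} (W-conference : IsConference W) where
    open IsConference W-conference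

    -- The sum is the total of all entries of W Wᵀ. Column sums are used rather than row sums
    -- because it is W Wᵀ, and not Wᵀ W, that the definition prescribes.
    ∑column-sum² : ∑[ j < n ] (column-sum W j * column-sum W j) ≡ + n * (+ n - 1ℤ)
    ∑column-sum² = begin
      ∑[ j < n ] (column-sum W j * column-sum W j)
        ≡⟨ sum-cong-≗ (λ j → trans (*-distribʳ-sum (column-sum W j) (λ i → W i j))
             (sum-cong-≗ λ i → *-distribˡ-sum (W i j) (λ k → W k j))) ⟩
      ∑[ j < n ] ∑[ i < n ] ∑[ k < n ] (W i j * W k j)
        ≡⟨ ∑-comm (λ j i → ∑[ k < n ] (W i j * W k j)) ⟩
      ∑[ i < n ] ∑[ j < n ] ∑[ k < n ] (W i j * W k j)
        ≡⟨ sum-cong-≗ (λ i → ∑-comm (λ j k → W i j * W k j)) ⟩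
      ∑[ i < n ] ∑[ k < n ] (W ⊗ transpose W) i k
        ≡⟨ sum-cong-≗ (λ i → trans (sum-cong-≗ (orthogonal i)) (sum-*-identity n i (λ _ → + n - 1ℤ))) ⟩
      ∑[ i < n ] (+ n - 1ℤ)
        ≡⟨ sum-const n (+ n - 1ℤ) ⟩
      + n * (+ n - 1ℤ) ∎

    -- Row `i` has squared length n - 1, its diagonal entry is 0, and each of the other n - 1
    -- squares is at most 1; hence all of these are exactly 1.
    entry² : ∀ i j → W i j * W i j ≡ 1ℤ - identity n i j
    entry² i j = sym (ℤ.i-j≡0⇒i≡j _ _ (sum-nonneg-zero defect defect≥0 ∑defect≡0 j))
      where
      defect : Fin n → ℤ
      defect l = 1ℤ - identity n i l - W i l * W i l
      defect≥0 : ∀ l → 0ℤ ≤ defect l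
      defect≥0 l with i Fin.≟ l
      ... | yes refl = ℤ.≤-reflexive (sym (cong (λ w → 0ℤ - w * w) (zeroDiagonal i)))
      ... | no _ with entries i l
      ...   | inj₁ w≡0         = subst (λ w → 0ℤ ≤ 1ℤ - w * w) (sym w≡0) (+≤+ ℕ.z≤n)
      ...   | inj₂ (inj₁ w≡-1) = subst (λ w → 0ℤ ≤ 1ℤ - w * w) (sym w≡-1) (+≤+ ℕ.z≤n)
      ...   | inj₂ (inj₂ w≡1)  = subst (λ w → 0ℤ ≤ 1ℤ - w * w) (sym w≡1) (+≤+ ℕ.z≤n)
      lemma : ∀ m → m * 1ℤ - 1ℤ - (m - 1ℤ) * 1ℤ ≡ 0ℤ
      lemma = solve-∀
      ∑defect≡0 : sum defect ≡ 0ℤ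
      ∑defect≡0 = begin
        ∑[ l < n ] (1ℤ - identity n i l - W i l * W i l)
          ≡⟨ ∑-distrib-- (λ l → 1ℤ - identity n i l) (λ l → W i l * W i l) ⟩
        ∑[ l < n ] (1ℤ - identity n i l) - ∑[ l < n ] (W i l * W i l)
          ≡⟨ cong₂ _-_ (∑-distrib-- (λ _ → 1ℤ) (identity n i)) (orthogonal i i) ⟩
        ∑[ l < n ] 1ℤ - sum (identity n i) - (+ n - 1ℤ) * identity n i i
          ≡⟨ cong₂ _-_ (cong₂ _-_ (sum-const n 1ℤ) (sum-identity n i)) (cong ((+ n - 1ℤ) *_) (identity-diagonal n i)) ⟩
        + n * 1ℤ - 1ℤ - (+ n - 1ℤ) * 1ℤ
          ≡⟨ lemma (+ n) ⟩
        0ℤ ∎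

    entry-parity : ∀ i j → ∃ λ e → W i j ≡ 1ℤ - identity n i j + + 2 * e
    entry-parity i j with entries i j
    ... | inj₁ w≡0         = 0ℤ  , trans (trans w≡0 (sym (cong (λ w → w * w) w≡0))) (trans (entry² i j) (sym (ℤ.+-identityʳ _)))
    ... | inj₂ (inj₁ w≡-1) = -1ℤ , trans w≡-1 (cong (λ t → t + -[1+ 1 ]) (trans (sym (cong (λ w → w * w) w≡-1)) (entry² i j)))
    ... | inj₂ (inj₂ w≡1)  = 0ℤ  , trans (trans w≡1 (sym (cong (λ w → w * w) w≡1))) (trans (entry² i j) (sym (ℤ.+-identityʳ _)))

    -- A column consists of one zero and n - 1 odd entries.
    column-sum-parity : ∀ j → ∃ λ e → column-sum W j ≡ + n - 1ℤ + + 2 * e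
    column-sum-parity j = sum e , (begin
      ∑[ i < n ] W i j
        ≡⟨ sum-cong-≗ (λ i → proj₂ (entry-parity i j)) ⟩
      ∑[ i < n ] (1ℤ - identity n i j + + 2 * e i)
        ≡⟨ ∑-distrib-+ (λ i → 1ℤ - identity n i j) (λ i → + 2 * e i) ⟩
      ∑[ i < n ] (1ℤ - identity n i j) + ∑[ i < n ] (+ 2 * e i)
        ≡⟨ cong₂ _+_ (∑-distrib-- (λ _ → 1ℤ) (λ i → identity n i j)) (sym (*-distribˡ-sum (+ 2) e)) ⟩
      ∑[ i < n ] 1ℤ - ∑[ i < n ] identity n i j + + 2 * sum e
        ≡⟨ cong (λ s → s + + 2 * sum e) (cong₂ _-_ (trans (sum-const n 1ℤ) (ℤ.*-identityʳ (+ n)))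
             (trans (sum-single (λ i → identity n i j) j (λ i i≢j → identity-off-diagonal n i≢j)) (identity-diagonal n j))) ⟩
      + n - 1ℤ + + 2 * sum e ∎)
      where
      e : Fin n → ℤ
      e i = proj₁ (entry-parity i j)

    module _ {x : ℤ} (n≡x²+2 : + n ≡ x * x + + 2) where

      deviation : Fin n → ℤ
      deviation j = (column-sum W j - x) * (column-sum W j - x) - 1ℤ

      ∑deviation : sum deviation ≡ + 2 * x * (+ n * x - excess W)
      ∑deviation = begin
        ∑[ j < n ] ((c j - x) * (c j - x) - 1ℤ)
          ≡⟨ sum-cong-≗ (λ j → expand (c j) x) ⟩
        ∑[ j < n ] (c j * c j + (- (+ 2 * x) * c j + (x * x - 1ℤ)))
          ≡⟨ ∑-distrib-+ (λ j → c j * c j) (λ j → - (+ 2 * x) * c j + (x * x - 1ℤ)) ⟩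
        ∑[ j < n ] (c j * c j) + ∑[ j < n ] (- (+ 2 * x) * c j + (x * x - 1ℤ))
          ≡⟨ cong₂ _+_ ∑column-sum² (∑-distrib-+ (λ j → - (+ 2 * x) * c j) (λ _ → x * x - 1ℤ)) ⟩
        + n * (+ n - 1ℤ) + (∑[ j < n ] (- (+ 2 * x) * c j) + ∑[ j < n ] (x * x - 1ℤ))
          ≡⟨ cong (_+_ (+ n * (+ n - 1ℤ))) (cong₂ _+_
               (trans (sym (*-distribˡ-sum (- (+ 2 * x)) c)) (cong (- (+ 2 * x) *_) (sym (excess≡∑column-sum W))))
               (sum-const n (x * x - 1ℤ))) ⟩
        + n * (+ n - 1ℤ) + (- (+ 2 * x) * excess W + + n * (x * x - 1ℤ))
          ≡⟨ cong (λ t → + n * (t - 1ℤ) + (- (+ 2 * x) * excess W + + n * (x * x - 1ℤ))) n≡x²+2 ⟩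
        + n * (x * x + + 2 - 1ℤ) + (- (+ 2 * x) * excess W + + n * (x * x - 1ℤ))
          ≡⟨ collect (+ n) x (excess W) ⟩
        + 2 * x * (+ n * x - excess W) ∎
        where
        c = column-sum W
        expand : ∀ c x → (c - x) * (c - x) - 1ℤ ≡ c * c + (- (+ 2 * x) * c + (x * x - 1ℤ))
        expand = solve-∀
        collect : ∀ n x e → n * (x * x + + 2 - 1ℤ) + (- (+ 2 * x) * e + n * (x * x - 1ℤ)) ≡ + 2 * x * (n * x - e)
        collect = solve-∀

      excess-exact : x ≢ 0ℤ → (∀ j → deviation j ≡ 0ℤ) → excess W ≡ + n * x
      excess-exact x≢0 deviation≡0 = sym (ℤ.i-j≡0⇒i≡j (+ n * x) (excess W)
        (nonzero-cancel x (+ n * x - excess W) x≢0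
          (trans (sym ∑deviation) (trans (sum-cong-≗ deviation≡0) (sum-replicate-zero n)))))
        where
        nonzero-cancel : ∀ x y → x ≢ 0ℤ → + 2 * x * y ≡ 0ℤ → y ≡ 0ℤ
        nonzero-cancel x y x≢0 2xy≡0 = ℤ.*-cancelˡ-≡ (+ 2 * x) y 0ℤ {{ℤ.i*j≢0 (+ 2) x {{_}} {{ℤ.≢-nonZero x≢0}}}}
          (trans 2xy≡0 (sym (ℤ.*-zeroʳ (+ 2 * x))))

      excess-upper-bound : ℤ.Positive x → Even x → excess W ≤ + n * x
      excess-upper-bound x>0 (f , x≡2f) = ℤ.0≤i-j⇒j≤i (ℤ.*-cancelˡ-≤-pos 0ℤ (+ n * x - excess W) (+ 2 * x) {{2x>0}}
        (subst₂ _≤_ (sym (ℤ.*-zeroʳ (+ 2 * x))) ∑deviation (sum-nonneg deviation deviation≥0)))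
        where
        2x>0 : ℤ.Positive (+ 2 * x)
        2x>0 = double x x>0
          where
          double : ∀ y → ℤ.Positive y → ℤ.Positive (+ 2 * y)
          double +[1+ _ ] _ = _
        lemma : ∀ f e → + 2 * f * (+ 2 * f) + + 2 - 1ℤ + + 2 * e - + 2 * f ≡ 1ℤ + + 2 * (+ 2 * f * f + e - f)
        lemma = solve-∀
        odd-deviation : ∀ j → Odd (column-sum W j - x)
        odd-deviation j with column-sum-parity j
        ... | e , eq = + 2 * f * f + e - f , trans (cong₂ _-_ (trans eq (cong (λ t → t - 1ℤ + + 2 * e)
          (trans n≡x²+2 (cong (λ x → x * x + + 2) x≡2f)))) x≡2f) (lemma f e)
        deviation≥0 : ∀ j → 0ℤ ≤ deviation j
        deviation≥0 j = ℤ.i≤j⇒0≤j-i (≢0⇒square≥1 (column-sum W j - x)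
          λ c-x≡0 → odd⇒¬even (odd-deviation j) (0ℤ , c-x≡0))

  -- A matrix W = diag(a) C diag(σ) with σ chosen so that all column sums are near x.
  module Optimal
    (p : ℕ) (p-prime : Prime p) (p∤2 : ¬ + p ∣ + 2) (x : ℤ) (norm-1x : norm (1ℤ , x) ≡ + p) where

    open Residues p p-prime
    open GaussianPrime p p-prime

    P∣x²+1 : P ∣ x * x + 1ℤ
    P∣x²+1 = ∣-≡ ∣-refl (trans (ℤ.+-comm (x * x) 1ℤ) norm-1x)

    open QuadraticCharacter p p-prime p∤2 x P∣x²+1 using (nonresidue)
    open PaleyMatrix p p-prime p∤2 x P∣x²+1

    Unit : ℤ → Set
    Unit s = s ≡ 1ℤ ⊎ s ≡ -1ℤ

    unit² : ∀ {s} → Unit s → s * s ≡ 1ℤ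
    unit² (inj₁ refl) = refl
    unit² (inj₂ refl) = refl

    unit-* : ∀ {s t} → Unit s → Unit t → Unit (s * t)
    unit-* (inj₁ refl) (inj₁ refl) = inj₁ refl
    unit-* (inj₁ refl) (inj₂ refl) = inj₂ refl
    unit-* (inj₂ refl) (inj₁ refl) = inj₂ refl
    unit-* (inj₂ refl) (inj₂ refl) = inj₁ refl

    -- `r` is a row sum of `C` weighted by `a`, and σ is the sign given to the corresponding column
    -- of `W`, so that its sum becomes x ± 1.
    Near : ℤ → Set
    Near r = ∃ λ σ → Unit σ × (σ * r - x) * (σ * r - x) ≡ 1ℤ

    near : ∀ r σ s → Unit σ → Unit s → r ≡ σ * x + s → Near r
    near r σ s σ±1 s±1 refl = σ , σ±1 , trans (lemma σ s x)
      (trans (cong (λ t → (t * x + σ * s - x) * (t * x + σ * s - x)) (unit² σ±1))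
        (trans (lemma₂ σ s x) (trans (cong₂ _*_ (unit² σ±1) (unit² s±1)) refl)))
      where
      lemma : ∀ σ s x → (σ * (σ * x + s) - x) * (σ * (σ * x + s) - x) ≡ (σ * σ * x + σ * s - x) * (σ * σ * x + σ * s - x)
      lemma = solve-∀
      lemma₂ : ∀ σ s x → (1ℤ * x + σ * s - x) * (1ℤ * x + σ * s - x) ≡ σ * σ * (s * s)
      lemma₂ = solve-∀

    -- One of `a` and `b` is ±1 and the other is ±x, so a + b and b - a both have the form ±x ± 1; σ
    -- is the coefficient of x in `r`.
    near-combination : ∀ a b → OneAndMultiple x (a , b) → ∀ ε r → Unit ε → r ≡ ε * (a + b) ⊎ r ≡ ε * (b - a) → Near r
    near-combination a b (s , t , s²≡1 , t²≡1 , cases) ε r ε±1 r≡ = by-cases cases r≡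
      where
      s±1 = square≡1 s s²≡1
      t±1 = square≡1 t t²≡1
      neg±1 : ∀ {u} → Unit u → Unit (- u)
      neg±1 (inj₁ refl) = inj₂ refl
      neg±1 (inj₂ refl) = inj₁ refl
      lemma₁ : ∀ ε s t x → ε * (s + t * x) ≡ ε * t * x + ε * s
      lemma₁ = solve-∀
      lemma₂ : ∀ ε s t x → ε * (t * x - s) ≡ ε * t * x + ε * - s
      lemma₂ = solve-∀
      lemma₃ : ∀ ε s t x → ε * (t * x + s) ≡ ε * t * x + ε * s
      lemma₃ = solve-∀
      lemma₄ : ∀ ε s t x → ε * (s - t * x) ≡ ε * - t * x + ε * s
      lemma₄ = solve-∀
      by-cases : (a ≡ s × b ≡ t * x) ⊎ (a ≡ t * x × b ≡ s) → r ≡ ε * (a + b) ⊎ r ≡ ε * (b - a) → Near r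
      by-cases (inj₁ (a≡ , b≡)) (inj₁ r≡) = near r (ε * t) (ε * s) (unit-* ε±1 t±1) (unit-* ε±1 s±1)
        (trans r≡ (trans (cong₂ (λ a b → ε * (a + b)) a≡ b≡) (lemma₁ ε s t x)))
      by-cases (inj₁ (a≡ , b≡)) (inj₂ r≡) = near r (ε * t) (ε * - s) (unit-* ε±1 t±1) (unit-* ε±1 (neg±1 s±1))
        (trans r≡ (trans (cong₂ (λ a b → ε * (b - a)) a≡ b≡) (lemma₂ ε s t x)))
      by-cases (inj₂ (a≡ , b≡)) (inj₁ r≡) = near r (ε * t) (ε * s) (unit-* ε±1 t±1) (unit-* ε±1 s±1)
        (trans r≡ (trans (cong₂ (λ a b → ε * (a + b)) a≡ b≡) (lemma₃ ε s t x)))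
      by-cases (inj₂ (a≡ , b≡)) (inj₂ r≡) = near r (ε * - t) (ε * s) (unit-* ε±1 (neg±1 t±1)) (unit-* ε±1 s±1)
        (trans r≡ (trans (cong₂ (λ a b → ε * (b - a)) a≡ b≡) (lemma₄ ε s t x)))

    module _ (g : ℤ) (g-nonsquare : ∀ s → ¬ s * s ≈ g) where

      open Twist g g-nonsquare

      row-sum : Fin (suc p) → ℤ
      row-sum i = ∑[ l < suc p ] (C i l * a l)

      opaque
        row-near : ∀ i → Near (row-sum i)
        row-near i = from-row (C-row i)
          where
          from-row : SignedSumOrDifference (row-sum i) → Near (row-sum i)
          from-row (ε , ε±1 , r≡) = near-combination α β (two-squares-unique α β x α²+β²≡P norm-1x) ε (row-sum i) ε±1 r≡

      σ : Fin (suc p) → ℤ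
      σ i = proj₁ (row-near i)

      σ-unit : ∀ i → Unit (σ i)
      σ-unit i = proj₁ (proj₂ (row-near i))

      W : Matrix (suc p)
      W i j = a i * C i j * σ j

      W-column-sum : ∀ j → column-sum W j ≡ σ j * row-sum j
      W-column-sum j = trans
        (sum-cong-≗ λ i → trans (cong (λ c → a i * c * σ j) (C-symmetric i j)) (lemma (a i) (C j i) (σ j)))
        (sym (*-distribˡ-sum (σ j) (λ i → C j i * a i)))
        where
        lemma : ∀ a c s → a * c * s ≡ s * (c * a)
        lemma = solve-∀

      W-near : ∀ j → (column-sum W j - x) * (column-sum W j - x) ≡ 1ℤ
      W-near j = trans (cong (λ c → (c - x) * (c - x)) (W-column-sum j)) (proj₂ (proj₂ (row-near j)))

      W-conference : IsConference W
      W-conference = record { entries = entries ; zeroDiagonal = zeroDiagonal ; orthogonal = orthogonal }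
        where
        zeroDiagonal : ∀ i → W i i ≡ 0ℤ
        zeroDiagonal i = trans (cong (λ c → a i * c * σ i) (C-diagonal i)) (trans (cong (_* σ i) (ℤ.*-zeroʳ (a i))) (ℤ.*-zeroˡ (σ i)))
        entries : ∀ i j → W i j ≡ 0ℤ ⊎ W i j ≡ -1ℤ ⊎ W i j ≡ 1ℤ
        entries i j with i Fin.≟ j
        ... | yes refl = inj₁ (zeroDiagonal i)
        ... | no i≢j = inj₂ (Sum.swap (unit-* (unit-* (a-unit i) (C-off-diagonal i j i≢j)) (σ-unit j)))
        orthogonal : ∀ i j → (W ⊗ transpose W) i j ≡ ((+ suc p - 1ℤ) · identity (suc p)) i j
        orthogonal i j = begin
          ∑[ l < suc p ] (W i l * W j l)
            ≡⟨ sum-cong-≗ (λ l → trans (lemma (a i) (C i l) (σ l) (a j) (C j l))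
                 (trans (cong (a i * a j * (C i l * C j l) *_) (unit² {σ l} (σ-unit l)))
                 (ℤ.*-identityʳ (a i * a j * (C i l * C j l))))) ⟩
          ∑[ l < suc p ] (a i * a j * (C i l * C j l))
            ≡⟨ *-distribˡ-sum (a i * a j) (λ l → C i l * C j l) ⟨
          a i * a j * ∑[ l < suc p ] (C i l * C j l)
            ≡⟨ cong (a i * a j *_) (C-orthogonal i j) ⟩
          a i * a j * (P * identity (suc p) i j)
            ≡⟨ absorb (i Fin.≟ j) ⟩
          P * identity (suc p) i j
            ≡⟨ cong (_* identity (suc p) i j) (lemma₂ P) ⟩
          (+ suc p - 1ℤ) * identity (suc p) i j ∎
          where
          lemma : ∀ a c s b d → (a * c * s) * (b * d * s) ≡ a * b * (c * d) * (s * s)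
          lemma = solve-∀
          lemma₂ : ∀ q → q ≡ 1ℤ + q - 1ℤ
          lemma₂ = solve-∀
          absorb : Dec (i ≡ j) → a i * a j * (P * identity (suc p) i j) ≡ P * identity (suc p) i j
          absorb (yes refl) =
            trans (cong (_* (P * identity (suc p) i i)) (unit² {a i} (a-unit i))) (ℤ.*-identityˡ (P * identity (suc p) i i))
          absorb (no i≢j) = trans (cong (a i * a j *_) P*0) (trans (ℤ.*-zeroʳ (a i * a j)) (sym P*0))
            where
            P*0 : P * identity (suc p) i j ≡ 0ℤ
            P*0 = trans (cong (P *_) (identity-off-diagonal (suc p) i≢j)) (ℤ.*-zeroʳ P)

    optimal : Σ[ W ∈ Matrix (suc p) ] IsConference W × (∀ j → (column-sum W j - x) * (column-sum W j - x) ≡ 1ℤ)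
    optimal with nonresidue
    ... | g , g-nonsquare = W g g-nonsquare , W-conference g g-nonsquare , W-near g g-nonsquare

open ConferenceMatrices

open import Data.Integer.Base as ℤ using (ℤ; +_; 0ℤ; 1ℤ)
import Data.Integer.Divisibility.Signed as ℤ
import Data.Integer.Properties as ℤ
open import Data.Nat.Base using (ℕ; zero; suc; _+_; _*_; _^_; _%_; _/_; _≤_; _<_; s≤s; z≤n)
import Data.Nat.Divisibility as ℕ
import Data.Nat.DivMod as ℕ
import Data.Nat.Properties as ℕ
open import Data.Nat.Tactic.RingSolver using (solve-∀)
open import Data.Rational.Base as ℚ using ()
import Data.Rational.Properties as ℚ
import Data.Rational.Unnormalised.Base as ℚᵘ
import Data.Rational.Unnormalised.Properties as ℚᵘ

-- Arithmetic of the bound and assembly of the theorem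

/-cong-≃ : ∀ i j d → i ≡ j ℤ.* + suc d → i ℚ./ suc d ≡ j ℚ./ 1
/-cong-≃ i j d eq = ℚ.fromℚᵘ-cong {ℚᵘ.mkℚᵘ i d} {ℚᵘ.mkℚᵘ j 0} (ℚᵘ.*≡* (trans (ℤ.*-identityʳ i) eq))

/1-mono-≤ : ∀ {i j} → i ℤ.≤ j → i ℚ./ 1 ℚ.≤ j ℚ./ 1
/1-mono-≤ {i} {j} i≤j = ℚ.toℚᵘ-cancel-≤
  (ℚᵘ.≤-respˡ-≃ (ℚᵘ.≃-sym (ℚ.toℚᵘ-fromℚᵘ (ℚᵘ.mkℚᵘ i 0)))
  (ℚᵘ.≤-respʳ-≃ (ℚᵘ.≃-sym (ℚ.toℚᵘ-fromℚᵘ (ℚᵘ.mkℚᵘ j 0)))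
    (ℚᵘ.*≤* (subst₂ ℤ._≤_ (sym (ℤ.*-identityʳ i)) (sym (ℤ.*-identityʳ j)) i≤j))))

-- Here (2m)² < q < (2m + 1)². With k = 1 + 2h, the case m ≤ h gives k ≥ 2m + 1, too large, and m ≥
-- h + 2 gives k + 2 < 2m, too small.
k≡2m-1 : ∀ {m k} → 1 ≤ m → k % 2 ≡ 1 → k ^ 2 ≤ 4 * m ^ 2 + 1 → 4 * m ^ 2 + 1 < (k + 2) ^ 2 → ∃ λ h → m ≡ suc h × k ≡ 1 + h * 2
k≡2m-1 {m} {k} 1≤m k-odd k²≤q q<[k+2]² = h , ℕ.≤-antisym m≤1+h (ℕ.≰⇒> m≰h) , k≡1+2h
  where
  h = k / 2
  k≡1+2h : k ≡ 1 + h * 2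
  k≡1+2h = trans (ℕ.m≡m%n+[m/n]*n k 2) (cong (_+ h * 2) k-odd)
  m≰h : ¬ m ≤ h
  m≰h m≤h = ℕ.<⇒≱ q<k² k²≤q
    where
    lemma : ∀ m → 4 * (m * (m * 1)) + 1 + 4 * m ≡ (1 + m * 2) * ((1 + m * 2) * 1)
    lemma = solve-∀
    q<k² : 4 * m ^ 2 + 1 < k ^ 2
    q<k² = ℕ.<-≤-trans (ℕ.m<m+n (4 * m ^ 2 + 1) (ℕ.≤-trans 1≤m (ℕ.m≤n*m m 4)))
      (ℕ.≤-trans (ℕ.≤-reflexive (lemma m)) (ℕ.^-monoˡ-≤ 2 (subst (1 + m * 2 ≤_) (sym k≡1+2h) (s≤s (ℕ.*-monoˡ-≤ 2 m≤h)))))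
  m≤1+h : m ≤ suc h
  m≤1+h with m ℕ.≤? suc h
  ... | yes m≤1+h = m≤1+h
  ... | no  m≰1+h = contradiction q<[k+2]² (ℕ.≤⇒≯ (begin
    (k + 2) ^ 2        ≡⟨ cong (λ k → (k + 2) ^ 2) k≡1+2h ⟩
    (1 + h * 2 + 2) ^ 2 ≤⟨ ℕ.^-monoˡ-≤ 2 (ℕ.≤-trans (ℕ.n≤1+n _) (ℕ.≤-trans (ℕ.≤-reflexive (lemma₁ h)) (ℕ.*-monoˡ-≤ 2 (ℕ.≰⇒> m≰1+h)))) ⟩
    (m * 2) ^ 2        ≡⟨ lemma₂ m ⟩
    4 * m ^ 2          ≤⟨ ℕ.m≤m+n (4 * m ^ 2) 1 ⟩
    4 * m ^ 2 + 1      ∎))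
    where
    open ℕ.≤-Reasoning
    lemma₁ : ∀ h → suc (1 + h * 2 + 2) ≡ suc (suc h) * 2
    lemma₁ = solve-∀
    lemma₂ : ∀ m → m * 2 * (m * 2 * 1) ≡ 4 * (m * (m * 1))
    lemma₂ = solve-∀

-- With x = k + 1 = 2(h + 1), the second factor k² + 2k + q equals (x² - 1) + (x² + 1) = 2x², and
-- dividing by 2x leaves x.
excessBound≡ : ∀ q h → q ≡ 4 * suc h ^ 2 + 1 → excessBound q (1 + h * 2) ≡ + ((q + 1) * (2 * suc h)) ℚ./ 1
-- The argument `k + (suc k + 0)` is the predecessor of the denominator `2 * suc k`, as it unfolds.
excessBound≡ q h refl = /-cong-≃ (+ numerator) (+ value) (k + (suc k + 0)) (trans (cong (+_) (lemma h)) (ℤ.pos-* value (2 * suc k)))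
  where
  k = 1 + h * 2
  numerator = (q + 1) * (k ^ 2 + 2 * k + q)
  value = (q + 1) * (2 * suc h)
  lemma : ∀ h → (4 * (suc h * (suc h * 1)) + 1 + 1) *
      ((1 + h * 2) * ((1 + h * 2) * 1) + 2 * (1 + h * 2) + (4 * (suc h * (suc h * 1)) + 1)) ≡
    (4 * (suc h * (suc h * 1)) + 1 + 1) * (2 * suc h) * (2 * suc (1 + h * 2))
  lemma = solve-∀

norm-1x : ∀ m → norm (1ℤ , + (2 * m)) ≡ + (4 * m ^ 2 + 1)
norm-1x m = trans (cong (ℤ._+_ 1ℤ) (sym (ℤ.pos-* (2 * m) (2 * m)))) (cong (+_) (lemma m))
  where
  lemma : ∀ m → 1 + 2 * m * (2 * m) ≡ 4 * (m * (m * 1)) + 1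
  lemma = solve-∀

2∤p-of-p%4≡1 : ∀ {p} → p % 4 ≡ 1 → ¬ 2 ℕ.∣ p
2∤p-of-p%4≡1 {p} p%4≡1 2∣p = contradiction
  (ℕ.∣1⇒≡1 (ℕ.∣m+n∣m⇒∣n (subst (2 ℕ.∣_) p≡4k+1 2∣p) (ℕ.∣n⇒∣m*n (p / 4) (ℕ.divides 2 refl)))) λ ()
  where
  p≡4k+1 : p ≡ p / 4 * 4 + 1
  p≡4k+1 = trans (ℕ.m≡m%n+[m/n]*n p 4) (trans (cong (_+ p / 4 * 4) p%4≡1) (ℕ.+-comm 1 (p / 4 * 4)))

p∤2-of-p%4≡1 : ∀ {p} → Prime p → p % 4 ≡ 1 → ¬ p ℕ.∣ 2
p∤2-of-p%4≡1 p-prime p%4≡1 p∣2 with ℕ.∣⇒≤ p∣2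
p∤2-of-p%4≡1 p-prime ()    p∣2 | z≤n
p∤2-of-p%4≡1 p-prime p%4≡1 p∣2 | s≤s z≤n = ¬prime[1] p-prime
p∤2-of-p%4≡1 p-prime ()    p∣2 | s≤s (s≤s z≤n)

2m>0 : ∀ {m} → 1 ≤ m → ℤ.Positive (+ (2 * m))
2m>0 {suc _} _ = _

2m≢0 : ∀ {m} → 1 ≤ m → + (2 * m) ≢ 0ℤ
2m≢0 {suc _} _ ()

exponent≡1 : ∀ m p r → 1 ≤ m → Prime p → ¬ + 2 ℤ.∣ + p → ¬ + p ℤ.∣ + 2 → 1 ≤ r → 4 * m ^ 2 + 1 ≡ p ^ r → r ≡ 1
exponent≡1 m p r@(suc r-1) 1≤m p-prime 2∤p p∤2 1≤r q≡pʳ =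
  GaussianPrime.lebesgue p p-prime α β x r α²+β²≡P 2∤p (2m≢0 1≤m) 1≤r norm≡pʳ
  where
  x = + (2 * m)
  norm≡pʳ : norm (1ℤ , x) ≡ + (p ^ r)
  norm≡pʳ = trans (norm-1x m) (cong (+_) q≡pʳ)
  p∣x²+1 : + p ℤ.∣ x ℤ.* x ℤ.+ 1ℤ
  p∣x²+1 = ∣-≡ (GaussianPrime.P∣norm-suc p p-prime (1ℤ , x) r-1 norm≡pʳ) (ℤ.+-comm (x ℤ.* x) 1ℤ)
  open QuadraticCharacter p p-prime p∤2 x p∣x²+1 using (nonresidue)
  open PaleyMatrix.Twist p p-prime p∤2 x p∣x²+1 (proj₁ nonresidue) (proj₂ nonresidue) using (α; β; α²+β²≡P)

HasMaximumExcess : ℕ → ℤ → Set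
HasMaximumExcess n E = Σ[ W ∈ Matrix n ] IsConference W × excess W ≡ E
  × (∀ (W′ : Matrix n) → IsConference W′ → excess W′ ℤ.≤ E)

-- The order is a variable `n` with an equation, so that the result applies at `q + 1` without
-- transporting matrices from `suc p`.
extremal-conference-matrix : ∀ p m → 1 ≤ m → Prime p → ¬ + p ℤ.∣ + 2 → p ≡ 4 * m ^ 2 + 1 → ∀ n → n ≡ suc p →
  HasMaximumExcess n (+ (n * (2 * m)))
extremal-conference-matrix p m 1≤m p-prime p∤2 p≡4m²+1 n refl =
  conclude (Optimal.optimal p p-prime p∤2 x (trans (norm-1x m) (cong (+_) (sym p≡4m²+1))))
  where
  x = + (2 * m)
  n≡x²+2 : + n ≡ x ℤ.* x ℤ.+ + 2
  n≡x²+2 = trans (cong (λ p → + suc p) p≡4m²+1) (trans (cong (+_) (lemma m)) (cong (ℤ._+ + 2) (ℤ.pos-* (2 * m) (2 * m))))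
    where
    lemma : ∀ m → suc (4 * (m * (m * 1)) + 1) ≡ 2 * m * (2 * m) + 2
    lemma = solve-∀
  conclude : Σ[ W ∈ Matrix n ] IsConference W × (∀ j → (column-sum W j ℤ.- x) ℤ.* (column-sum W j ℤ.- x) ≡ 1ℤ) →
    HasMaximumExcess n (+ (n * (2 * m)))
  conclude (W , W-conference , near) = W , W-conference
    , trans (excess-exact W-conference n≡x²+2 (2m≢0 1≤m) (λ j → ℤ.i≡j⇒i-j≡0 (near j))) (sym (ℤ.pos-* n (2 * m)))
    , λ W′ W′-conference → subst (excess W′ ℤ.≤_) (sym (ℤ.pos-* n (2 * m)))
        (excess-upper-bound W′-conference n≡x²+2 (2m>0 1≤m) (+ m , ℤ.pos-* 2 m))

theorem1p2 : ∀ (m q p r k : ℕ) →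
    1 ≤ m →
    q ≡ 4 * m ^ 2 + 1 →
    Prime p →
    p % 4 ≡ 1 →
    1 ≤ r →
    q ≡ p ^ r →
    -- k odd with k ≤ √q < k + 2, in squared form
    k % 2 ≡ 1 →
    k ^ 2 ≤ q →
    q < (k + 2) ^ 2 →
    Σ[ W ∈ Matrix (q + 1) ] (IsConference W
      × excess W ℚ./ 1 ≡ excessBound q k
      × (∀ (W′ : Matrix (q + 1)) → IsConference W′ → excess W′ ℚ./ 1 ℚ.≤ excessBound q k))
theorem1p2 m q p r k 1≤m q≡4m²+1 p-prime p%4≡1 1≤r q≡pʳ k-odd k²≤q q<[k+2]² =
  conclude (extremal-conference-matrix p m 1≤m p-prime p∤2 (trans p≡q q≡4m²+1) (q + 1) (trans (ℕ.+-comm q 1) (cong suc (sym p≡q))))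
  where
  2∤p : ¬ 2 ℕ.∣ p
  2∤p = 2∤p-of-p%4≡1 p%4≡1
  p∤2 : ¬ + p ℤ.∣ + 2
  p∤2 p∣2 = p∤2-of-p%4≡1 p-prime p%4≡1 (ℤ.∣⇒∣ᵤ p∣2)
  p≡q : p ≡ q
  p≡q = sym (trans q≡pʳ (trans
    (cong (p ^_) (exponent≡1 m p r 1≤m p-prime (λ 2∣p → 2∤p (ℤ.∣⇒∣ᵤ 2∣p)) p∤2 1≤r (trans (sym q≡4m²+1) q≡pʳ)))
    (ℕ.*-identityʳ p)))
  bound≡ : excessBound q k ≡ + ((q + 1) * (2 * m)) ℚ./ 1
  bound≡ = from-half (k≡2m-1 1≤m k-odd (subst (k ^ 2 ≤_) q≡4m²+1 k²≤q) (subst (_< (k + 2) ^ 2) q≡4m²+1 q<[k+2]²))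
    where
    from-half : (∃ λ h → m ≡ suc h × k ≡ 1 + h * 2) → excessBound q k ≡ + ((q + 1) * (2 * m)) ℚ./ 1
    from-half (h , m≡1+h , k≡1+2h) = trans (cong (excessBound q) k≡1+2h)
      (trans (excessBound≡ q h (trans q≡4m²+1 (cong (λ m → 4 * m ^ 2 + 1) m≡1+h)))
        (cong (λ m → + ((q + 1) * (2 * m)) ℚ./ 1) (sym m≡1+h)))
  conclude : HasMaximumExcess (q + 1) (+ ((q + 1) * (2 * m))) →
    Σ[ W ∈ Matrix (q + 1) ] (IsConference W × excess W ℚ./ 1 ≡ excessBound q k
      × (∀ (W′ : Matrix (q + 1)) → IsConference W′ → excess W′ ℚ./ 1 ℚ.≤ excessBound q k))
  conclude (W , W-conference , excess≡ , bound) = W , W-conference , trans (cong (ℚ._/ 1) excess≡) (sym bound≡)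
    , λ W′ W′-conference → subst (excess W′ ℚ./ 1 ℚ.≤_) (sym bound≡) (/1-mono-≤ (bound W′ W′-conference))
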